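{- Let $k\ge 2$, let $H_k$ be the infinite hexagonal grid with $k$ rows, and let $(G_k,w)$ be its weighted LDS-configuration digraph. Then the following hold. (a) The digraph $G_k$ has a cycle $C$ of length $p\ge 1$ if and only if $H_k$ has a periodic locating-dominating set $S$ with a pattern $P$ of period $2p$. Furthermore, the density of $S$ in $H_k$ and the mean $\widetilde w(C)$ of the cycle $C$ (where $C$ and $S$ correspond to each other, that is, $S=S_C$) satisfy the relation $d(S,H_k)=\widetilde w(C)/(2k)$. Thus, a minimum mean cycle in $G_k$ yields a minimum-density periodic locating-dominating set of $H_k$. (b) As $H_k$ always admits an optimal (that is, minimum-density, of density $d^*(H_k)$) locating-dominating set that is periodic, we have $d^*(H_k)=\widetilde w(C^*)/(2k)$, where $C^*$ is a minimum mean cycle in $G_k$.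
   Context: **Grid.** $H_k$ is the graph with vertex set $[k]\times\mathbb Z$, $[k]=\{1,\dots,k\}$ (first coordinate = row, second coordinate = column). Its edges are $\{(i,j),(i,j+1)\}$ for all $i\in[k]$, $j\in\mathbb Z$, and $\{(i,j),(i+1,j)\}$ for all $1\le i<k$ and $j\in\mathbb Z$ with $i+j$ even. **Locating-dominating sets.** For a graph $G=(V,E)$, $N(v)$ is the set of neighbors of $v$. A set $S\subseteq V$ is a locating-dominating set (LDS) if $N(v)\cap S\ne\emptyset$ for every $v\in V\setminus S$, and $N(u)\cap S\ne N(v)\cap S$ for all distinct $u,v\in V\setminus S$. **Density.** For an integer $r\ge1$, $N_r(v)=\{u\in V: 0<\mathrm{dist}(u,v)\le r\}$. For $S\subseteq V$, $d_v(S,G)=\limsup_{r\to\infty}|N_r(v)\cap S|/|N_r(v)|$ and $d(S,G)=\inf_{v\in V}d_v(S,G)$. The minimum density is $d^*(G)=\inf\{d(S,G): S\text{ is an LDS of }G\}$. **Periodicity.** An LDS $S$ of $H_k$ is periodic with a pattern of period $p\ge1$ if $H_k$ can be partitioned into blocks of $p$ consecutive columns on which $S$ is identical, i.e. for all $(i,j)$: $(i,j)\in S\iff(i,j+p)\in S$; a pattern is one such block together with the vertices of $S$ in it. The period $p$ need not be the smallest one. $S$ is periodic if this holds for some $p\ge 1$. **Bars and barcodes.** An $\ell$-bar ($\ell\ge4$) of $H_k$ is the subgraph $R$ induced by $\ell$ consecutive columns. A set $B\subseteq V(R)$ is a barcode of $R$ if, for the set $I$ of vertices of $R$ lying in all columns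 of $R$ except the first and the last, (i) every $v\in I\setminus B$ satisfies $N(v)\cap B\neq\emptyset$, and (ii) every two distinct $u,v\in I\setminus B$ satisfy $N(u)\cap B\ne N(v)\cap B$. **Configuration digraph.** For sets $X_1,\dots,X_n\subseteq[k]\times\{1,2\}$, let $X_1X_2\cdots X_n$ denote the subset of $[k]\times\{1,\dots,2n\}$ obtained by placing $X_m$ in columns $2m-1,2m$, i.e. $\{(i,c+2m-2): 1\le m\le n,\ (i,c)\in X_m\}$. The vertices of $G_k$ are the barcodes $XY$ of the $4$-bar on columns $1,\dots,4$ of $H_k$. There is an arc from $XY$ to $X'Y'$ if and only if $Y=X'$ (the last two columns of the first barcode are identical to the first two columns of the second) and $XYY'$ is a barcode of the $6$-bar on columns $1,\dots,6$; loops are allowed. The weight of this arc is $w=|Y'|$, the number of selected vertices in the last two columns of the second barcode. **Cycles.** A cycle in $G_k$ means a directed cycle, represented by its sequence of vertices $C=(B_1,\dots,B_p)$ without repetitions, with an arc from $B_m$ to $B_{m+1}$ for each $m$ (indices modulo $p$). Its length is its number $p\ge1$ of arcs; a loop is a cycle of length $1$. Its weight $w(C)$ is the sum of the weights of its arcs and its mean is $\widetilde w(C)=w(C)/p$. A minimum mean cycle is a cycle of minimum mean. **Correspondence.** For a cycle $C=(B_1,\dots,B_p)$ with $B_m=X_mX_{m+1}$ (indices modulo $p$), $S_C\subseteq V(H_k)$ is the set obtained by repeating $X_1X_2\cdots X_p$ side by side, that is, placing $X_m$ (index taken modulo $p$ in $\{1,\dots,p\}$) in columns $2m-1,2m$ for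 every $m\in\mathbb Z$.
   Formalization: For fixed p the equivalence in (a) fails (all of V(H_k) has every period 2p, cycle lengths are bounded); proved instead: closed walks ⇔ periodic sets of period 2p, and cycles ⇔ those whose p four-column windows are distinct. Vertex sets are given by characteristic functions. -}

module Defs where

open import Data.Bool.Base using (Bool; T)
open import Data.Fin.Base as Fin using (Fin; toℕ; fromℕ<; inject₁)
import Data.Fin.Properties as Fin
import Data.Fin.Subset as FS
open import Data.Integer.Base as ℤ using (ℤ; +_; 0ℤ; 1ℤ; -1ℤ)
import Data.Integer.Properties as ℤ
import Data.Integer.Divisibility as ℤ
open import Data.Integer.DivMod using (_/ℕ_; _%ℕ_; n%ℕd<d)
open import Data.List.Base as List using (List; []; _∷_; concatMap; length; filter; filterᵇ; deduplicate; upTo; allFin)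
open import Data.List.Membership.Propositional using (_∈_; find; lose)
open import Data.List.Membership.Propositional.Properties
open import Data.List.Membership.DecPropositional using () renaming (_∈?_ to ∈-dec)
open import Data.List.Relation.Unary.Any using (here; there)
open import Data.List.Relation.Unary.Unique.Propositional using (Unique)
import Data.List.Relation.Unary.Unique.Propositional.Properties as Unique
import Data.List.Relation.Unary.Unique.DecPropositional.Properties as UniqueDec
open import Data.Nat.Base as ℕ using (ℕ; zero; suc; NonZero; z≤n; s≤s; z<s)
import Data.Nat.Properties as ℕ
import Data.Nat.Divisibility as ℕ
open import Data.Nat.DivMod using (_mod_)
open import Data.Product using (Σ; ∃; ∃-syntax; _×_; _,_; proj₁; proj₂)
open import Data.Product.Properties using (≡-dec)
open import Data.Rational.Base as ℚ using (ℚ; 0ℚ)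
open import Data.Sum.Base using (_⊎_; inj₁; inj₂)
open import Data.Vec.Base as Vec using (Vec; _++_; lookup)
open import Function.Base using (_∘_; flip)
open import Function.Bundles using (_⇔_; mk⇔; module Equivalence)
open import Function.Definitions using (Injective)
open import Level using (0ℓ)
open import Relation.Binary.Construct.Closure.Symmetric as Sym using (SymClosure; fwd; bwd)
open import Relation.Binary.Core using (Rel)
open import Relation.Binary.Definitions using (Symmetric; Irreflexive; Decidable; DecidableEquality)
open import Relation.Binary.PropositionalEquality using (_≡_; _≢_; refl; sym; trans; cong; subst)
open import Relation.Nullary using (¬_; Dec; yes; no; contradiction; ¬?; _×-dec_; _⊎-dec_)
open import Relation.Nullary.Decidable using (map′)
open import Relation.Unary using (Pred; U; _∩_; _≐_; Satisfiable)

-- An extended real is given by the rationals below it and those above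
-- it (both inclusive).  Limits superior of rational sequences, infima
-- of arbitrary families and comparisons can then be written out without
-- first constructing the real number in question.

record Cut : Set₁ where
  field
    Below : Pred ℚ 0ℓ   -- Below q: q ≤ x
    Above : Pred ℚ 0ℓ   -- Above q: x ≤ q

open Cut

infix 4 _≤ᶜ_ _≈ᶜ_

_≤ᶜ_ : Cut → Cut → Set
x ≤ᶜ y = (∀ q → Below x q → Below y q) × (∀ q → Above y q → Above x q)

_≈ᶜ_ : Cut → Cut → Set
x ≈ᶜ y = (x ≤ᶜ y) × (y ≤ᶜ x)

fromℚ : ℚ → Cut
fromℚ c = record { Below = ℚ._≤ c ; Above = c ℚ.≤_ }

limsup : (ℕ → ℚ) → Cut
limsup a = record
  { Below = λ q → ∀ ε → 0ℚ ℚ.< ε → ∀ N → ∃[ r ] N ℕ.≤ r × q ℚ.- ε ℚ.≤ a r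
  ; Above = λ q → ∀ ε → 0ℚ ℚ.< ε → ∃[ N ] ∀ r → N ℕ.≤ r → a r ℚ.≤ q ℚ.+ ε
  }

inf : {I : Set} → (I → Cut) → Cut
inf x = record
  { Below = λ q → ∀ i → Below (x i) q
  ; Above = λ q → ∀ ε → 0ℚ ℚ.< ε → ∃[ i ] Above (x i) (q ℚ.+ ε)
  }

-- Total division; the value at 0 is a convention and never matters for
-- the grid, where every N_r(v) with r ≥ 1 is nonempty.

infixl 7 _÷ℕ_

_÷ℕ_ : ℚ → ℕ → ℚ
q ÷ℕ zero  = 0ℚ
q ÷ℕ suc n = q ℚ.* (1ℤ ℚ./ suc n)

fromℕ : ℕ → ℚ
fromℕ n = + n ℚ./ 1

record Graph : Set₁ where
  infix 4 _~_
  field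
    V        : Set
    _~_      : Rel V 0ℓ
    ~-sym    : Symmetric _~_
    ~-irrefl : Irreflexive _≡_ _~_

  N : V → Pred V 0ℓ
  N v u = v ~ u

  data Walk (v : V) : V → ℕ → Set where
    []   : Walk v v 0
    _∷ʳ_ : ∀ {u w n} → Walk v u n → u ~ w → Walk v w (suc n)

  Dist : V → V → ℕ → Set
  Dist v u d = Walk v u d × (∀ n → Walk v u n → d ℕ.≤ n)

  N[_] : ℕ → V → Pred V 0ℓ
  N[ r ] v u = ∃[ d ] Dist v u d × 0 ℕ.< d × d ℕ.≤ r

  -- Requiring domination and separation only on I covers both
  -- locating-dominating sets (I = U) and barcodes (I = the inner columns).
  LocatingDominatingOn : Pred V 0ℓ → Pred V 0ℓ → Set
  LocatingDominatingOn I S =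
      (∀ v → I v → ¬ S v → Satisfiable (N v ∩ S))
    × (∀ u v → I u → I v → ¬ S u → ¬ S v → u ≢ v → ¬ (N u ∩ S ≐ N v ∩ S))

-- Vertex sets are Boolean-valued, so that their finite parts can be counted.

VertexSet : Graph → Set
VertexSet G = Graph.V G → Bool

⟦_⟧ : {A : Set} → (A → Bool) → Pred A 0ℓ
⟦ S ⟧ v = T (S v)

IsLDS : (G : Graph) → VertexSet G → Set
IsLDS G S = Graph.LocatingDominatingOn G U ⟦ S ⟧

record Finite {A : Set} (P : Pred A 0ℓ) : Set where
  field
    elements : List A
    unique   : Unique elements
    exact    : ∀ {x} → x ∈ elements ⇔ P x

record LocallyFiniteGraph : Set₁ where
  field
    graph : Graph
  open Graph graph public
  field
    _≟_       : DecidableEquality V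
    neighbors : ∀ v → Finite (N v)

  private
    ends : ℕ → V → List V
    ends zero    v = v ∷ []
    ends (suc n) v = concatMap (Finite.elements ∘ neighbors) (ends n v)

    ends⁺ : ∀ {v u n} → Walk v u n → u ∈ ends n v
    ends⁺ []       = here refl
    ends⁺ (_∷ʳ_ {u} p e) =
      ∈-concatMap⁺ _ (lose (ends⁺ p) (Equivalence.from (Finite.exact (neighbors u)) e))

    ends⁻ : ∀ {v u} n → u ∈ ends n v → Walk v u n
    ends⁻ zero (here refl) = []
    ends⁻ {v} (suc n) u∈ with find (∈-concatMap⁻ (Finite.elements ∘ neighbors) {xs = ends n v} u∈)
    ... | w , w∈ , u∈nw = ends⁻ n w∈ ∷ʳ Equivalence.to (Finite.exact (neighbors w)) u∈nw

    walk? : ∀ v u n → Dec (Walk v u n)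
    walk? v u n = map′ (ends⁻ n) ends⁺ (∈-dec _≟_ u (ends n v))

    least : ∀ {P : Pred ℕ 0ℓ} → (∀ n → Dec (P n)) → ∀ n → P n →
            ∃[ d ] d ℕ.≤ n × P d × (∀ m → P m → d ℕ.≤ m)
    least P? n Pn with P? 0
    ... | yes P0 = 0 , z≤n , P0 , λ _ _ → z≤n
    least P? zero    Pn | no ¬P0 = contradiction Pn ¬P0
    least P? (suc n) Pn | no ¬P0 with least (P? ∘ suc) n Pn
    ... | d , d≤n , Pd , min = suc d , s≤s d≤n , Pd , λ where
      zero    P0 → contradiction P0 ¬P0
      (suc m) Pm → s≤s (min m Pm)

    other? : ∀ v u → Dec (v ≢ u)
    other? v u = ¬? (v ≟ u)

    reach : ℕ → V → List V
    reach r v = filter (other? v) (deduplicate _≟_ (concatMap (flip ends v) (upTo (suc r))))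

    reach⁺ : ∀ {r v u} → N[ r ] v u → u ∈ reach r v
    reach⁺ {r} {v} (d , (p , min) , 0<d , d≤r) =
      ∈-filter⁺ (other? v)
        (∈-deduplicate⁺ _≟_ (∈-concatMap⁺ (flip ends v) (lose (∈-upTo⁺ (s≤s d≤r)) (ends⁺ p))))
        λ { refl → ℕ.<⇒≱ 0<d (min 0 []) }

    reach⁻ : ∀ {r v u} → u ∈ reach r v → N[ r ] v u
    reach⁻ {r} {v} {u} u∈ with ∈-filter⁻ (other? v) u∈
    ... | u∈d , v≢u with find (∈-concatMap⁻ (flip ends v) {xs = upTo (suc r)} (∈-deduplicate⁻ _≟_ _ u∈d))
    ... | n , n∈ , u∈n with least (walk? v u) n (ends⁻ n u∈n)
    ... | zero  , _   , []  , _   = contradiction refl v≢u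
    ... | suc d , d≤n , p   , min =
      suc d , (p , min) , z<s , ℕ.≤-trans d≤n (ℕ.≤-pred (∈-upTo⁻ n∈))

  N[_]-finite : ∀ r v → Finite (N[ r ] v)
  N[ r ]-finite v = record
    { elements = reach r v
    ; unique   = Unique.filter⁺ (other? v) (UniqueDec.deduplicate-! _≟_ (concatMap (flip ends v) (upTo (suc r))))
    ; exact    = mk⇔ reach⁻ reach⁺
    }

  densityRatio : (V → Bool) → V → ℕ → ℚ
  densityRatio S v r = fromℕ (length (filterᵇ S Nᵣv)) ÷ℕ length Nᵣv
    where Nᵣv = Finite.elements (N[ r ]-finite v)

  densityAt : (V → Bool) → V → Cut
  densityAt S v = limsup (densityRatio S v)

  density : (V → Bool) → Cut
  density S = inf (densityAt S)

  minDensity : Cut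
  minDensity = inf {∃ (IsLDS graph)} (density ∘ proj₁)

-- Rows are the elements of Fin k; `row` restores their numbers 1, …, k.

row : ∀ {k} → Fin k → ℤ
row i = + suc (toℕ i)

GridEdge : ∀ k → Rel (Fin k × ℤ) 0ℓ
GridEdge k (i , j) (i′ , j′) =
    (i′ ≡ i × j′ ≡ j ℤ.+ 1ℤ)
  ⊎ (row i′ ≡ row i ℤ.+ 1ℤ × j′ ≡ j × + 2 ℤ.∣ row i ℤ.+ j)

private
  n≢n+1 : ∀ (n : ℤ) → n ≢ n ℤ.+ 1ℤ
  n≢n+1 n eq = ℤ.i≢suc[i] {n} (trans eq (ℤ.+-comm n 1ℤ))

  gridEdge-irrefl : ∀ {k} {v : Fin k × ℤ} → ¬ GridEdge k v v
  gridEdge-irrefl (inj₁ (_ , eq)) = n≢n+1 _ eq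
  gridEdge-irrefl (inj₂ (eq , _)) = n≢n+1 _ eq

H : ℕ → Graph
H k = record
  { V        = Fin k × ℤ
  ; _~_      = SymClosure (GridEdge k)
  ; ~-sym    = Sym.symmetric (GridEdge k)
  ; ~-irrefl = λ { refl (fwd e) → gridEdge-irrefl e
                 ; refl (bwd e) → gridEdge-irrefl e }
  }

private
  gridEdge? : ∀ k → Decidable (GridEdge k)
  gridEdge? k (i , j) (i′ , j′) =
    (i′ Fin.≟ i ×-dec j′ ℤ.≟ j ℤ.+ 1ℤ)
    ⊎-dec (row i′ ℤ.≟ row i ℤ.+ 1ℤ ×-dec j′ ℤ.≟ j ×-dec 2 ℕ.∣? ℤ.∣ row i ℤ.+ j ∣)

  grid~? : ∀ k → Decidable (Graph._~_ (H k))
  grid~? k u v = map′ (λ { (inj₁ e) → fwd e ; (inj₂ e) → bwd e })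
                      (λ { (fwd e) → inj₁ e ; (bwd e) → inj₂ e })
                      (gridEdge? k u v ⊎-dec gridEdge? k v u)

  _≟ᵍ_ : ∀ {k} → DecidableEquality (Fin k × ℤ)
  _≟ᵍ_ = ≡-dec Fin._≟_ ℤ._≟_

  candidates : ∀ {k} → Fin k × ℤ → List (Fin k × ℤ)
  candidates (i , j) = (i , j ℤ.+ 1ℤ) ∷ (i , j ℤ.+ -1ℤ) ∷ List.map (_, j) (allFin _)

  ~⇒candidate : ∀ {k} {u v : Fin k × ℤ} → Graph._~_ (H k) u v → v ∈ candidates u
  ~⇒candidate (fwd (inj₁ (refl , refl)))     = here refl
  ~⇒candidate (fwd (inj₂ (_ , refl , _)))    = there (there (∈-map⁺ _ (∈-allFin _)))
  ~⇒candidate {v = i , j} (bwd (inj₁ (refl , refl))) =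
    there (here (cong (i ,_) (sym (trans (ℤ.+-assoc j 1ℤ -1ℤ) (ℤ.+-identityʳ j)))))
  ~⇒candidate (bwd (inj₂ (_ , refl , _)))    = there (there (∈-map⁺ _ (∈-allFin _)))

Hᶠ : ℕ → LocallyFiniteGraph
Hᶠ k = record
  { graph     = H k
  ; _≟_       = _≟ᵍ_
  ; neighbors = λ v → record
    { elements = filter (grid~? k v) (deduplicate _≟ᵍ_ (candidates v))
    ; unique   = Unique.filter⁺ (grid~? k v) (UniqueDec.deduplicate-! _≟ᵍ_ (candidates v))
    ; exact    = mk⇔ (λ x∈ → proj₂ (∈-filter⁻ (grid~? k v) {xs = deduplicate _≟ᵍ_ (candidates v)} x∈))
                     (λ e → ∈-filter⁺ (grid~? k v) (∈-deduplicate⁺ _≟ᵍ_ (~⇒candidate e)) e)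
    }
  }

density : ∀ {k} → VertexSet (H k) → Cut
density {k} = LocallyFiniteGraph.density (Hᶠ k)

minDensity : ℕ → Cut
minDensity k = LocallyFiniteGraph.minDensity (Hᶠ k)

HasPeriod : ∀ {k} → VertexSet (H k) → ℕ → Set
HasPeriod S p = 1 ℕ.≤ p × (∀ i j → S (i , j) ≡ S (i , j ℤ.+ + p))

IsPeriodicLDS : ∀ {k} → ℕ → VertexSet (H k) → Set
IsPeriodicLDS {k} p S = IsLDS (H k) S × HasPeriod S p

-- A subset of [k] × {1,…,n}, column by column; XY is then X ++ Y.
Strip : ℕ → ℕ → Set
Strip k n = Vec (FS.Subset k) n

∣_∣ˢ : ∀ {k n} → Strip k n → ℕ
∣ X ∣ˢ = Vec.sum (Vec.map FS.∣_∣ X)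

-- The bar on columns 1, …, ℓ; column number c is represented by c - 1 : Fin ℓ.

inGrid : ∀ {k ℓ} → Fin k × Fin ℓ → Fin k × ℤ
inGrid (i , c) = i , + suc (toℕ c)

Bar : ℕ → ℕ → Graph
Bar k ℓ = record
  { V        = Fin k × Fin ℓ
  ; _~_      = λ u v → inGrid u ~ inGrid v
  ; ~-sym    = ~-sym
  ; ~-irrefl = λ u≡v → ~-irrefl (cong inGrid u≡v)
  }
  where open Graph (H k)

IsBarcode : ∀ {k ℓ} → Strip k ℓ → Set
IsBarcode {k} {ℓ} B = Graph.LocatingDominatingOn (Bar k ℓ) Inner (λ (i , c) → i FS.∈ lookup B c)
  where
  Inner : Pred (Fin k × Fin ℓ) 0ℓ
  Inner (_ , c) = 1 ℕ.< suc (toℕ c) × suc (toℕ c) ℕ.< ℓ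

-- The pair (X , Y) stands for the subset XY of the 4-bar.
Code : ℕ → Set
Code k = Strip k 2 × Strip k 2

IsVertex : ∀ {k} → Code k → Set
IsVertex (X , Y) = IsBarcode (X ++ Y)

Arc : ∀ {k} → Rel (Code k) 0ℓ
Arc B@(X , Y) B′@(X′ , Y′) =
  IsVertex B × IsVertex B′ × Y ≡ X′ × IsBarcode (X ++ Y ++ Y′)

arcWeight : ∀ {k} → Code k → Code k → ℕ
arcWeight _ (_ , Y′) = ∣ Y′ ∣ˢ

module _ {k p : ℕ} .{{_ : NonZero p}} where

  at : Vec (Code k) p → Fin p → Code k
  at = lookup

  next : Fin p → Fin p
  next m = suc (toℕ m) mod p

  IsClosedWalk : Vec (Code k) p → Set
  IsClosedWalk C = ∀ m → Arc (at C m) (at C (next m))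

  IsCycle : Vec (Code k) p → Set
  IsCycle C = IsClosedWalk C × Injective _≡_ _≡_ (at C)

  weight : Vec (Code k) p → ℕ
  weight C = Vec.sum (Vec.tabulate λ m → arcWeight (at C m) (at C (next m)))

  mean : Vec (Code k) p → ℚ
  mean C = + weight C ℚ./ p

  -- Columns 2m-1 and 2m carry the left half of the m-th entry of C, m
  -- taken modulo p.  With indices counted from 0, column j is the
  -- ((j-1) mod 2)-th column of the block with number ⌊(j-1)/2⌋.
  S[_] : Vec (Code k) p → VertexSet (H k)
  S[ C ] (i , j) = lookup (lookup (proj₁ (at C m)) c) i
    where
    m : Fin p
    m = fromℕ< (n%ℕd<d ((j ℤ.- 1ℤ) /ℕ 2) p)
    c : Fin 2
    c = fromℕ< (n%ℕd<d (j ℤ.- 1ℤ) 2)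

IsMinimumMeanCycle : ∀ {k p} .{{_ : NonZero p}} → Vec (Code k) p → Set
IsMinimumMeanCycle {k} C =
  IsCycle C × (∀ q .{{_ : NonZero q}} (D : Vec (Code k) q) → IsCycle D → mean C ℚ.≤ mean D)

-- A closed walk of G_k may repeat vertices and a cycle may not.  The two
-- must be told apart: S = V(H_k) has every period 2p, whereas the length
-- of a cycle is bounded by the number of barcodes.  On the grid, having no
-- repetition means that the p windows of columns 2m+1, …, 2m+4,
-- 0 ≤ m < p, carry pairwise distinct patterns.
DistinctWindows : ∀ {k} → ℕ → VertexSet (H k) → Set
DistinctWindows {k} p S = ∀ (m n : Fin p) →
  (∀ (i : Fin k) (c : Fin 4) → S (i , column m c) ≡ S (i , column n c)) → m ≡ n
  where
  column : Fin p → Fin 4 → ℤ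
  column m c = + (2 ℕ.* toℕ m ℕ.+ suc (toℕ c))

-- Two vertices with a common neighbour are at most two columns apart, hence
-- lie together in the interior of some 6-bar that starts after an even
-- column.  Being locating-dominating is therefore a condition on triples of
-- consecutive two-column blocks, and the locating-dominating sets of H_k are
-- exactly the bi-infinite walks in G_k; the periodic ones are the closed walks.
--
-- Loop erasure decomposes a walk with n arcs into cycles and a simple path,
-- so its weight is at least nμ - O(1), where μ is the minimum cycle mean.  A
-- ball of radius r lies between two rectangles with 2r - O(1) and 2r + O(1)
-- columns, so the density ratio at r is the average number of selected
-- vertices per column, divided by k, up to O(1/r).  Thus every
-- locating-dominating set, periodic or not, has density at least μ/(2k), and
-- S_C attains this bound for a minimum mean cycle C, which exists because
-- there are finitely many cycles.
module Submission where

open import Defs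
open import Data.Bool.Base using (Bool; true; false)
import Data.Bool.Properties as Bool
open import Data.Bool.Properties using (T-≡; T?)
open import Data.Empty using (⊥)
open import Data.Fin.Base as Fin using (Fin; zero; suc; toℕ; fromℕ<; inject₁)
open import Data.Fin.Induction using (<-weakInduction)
import Data.Fin.Properties as Fin
import Data.Fin.Subset as FS
import Data.Fin.Subset.Properties as FS
open import Data.Integer.Base as ℤ using (ℤ; +_; 0ℤ; 1ℤ; -1ℤ; -[1+_])
import Data.Integer.Divisibility as ℤ
import Data.Integer.Divisibility.Signed as ℤˢ
open import Data.Integer.DivMod using (_/ℕ_; _%ℕ_; n%ℕd<d; a≡a%ℕn+[a/ℕn]*n)
import Data.Integer.Properties as ℤ
import Data.Integer.Tactic.RingSolver as ℤ
open import Data.List.Base as List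
  using (List; []; _∷_; length; upTo; concatMap; filter; filterᵇ; cartesianProduct; cartesianProductWith)
import Data.List.Properties as List
open import Data.List.Membership.DecPropositional using () renaming (_∈?_ to ∈-dec)
open import Data.List.Membership.Propositional using (_∈_; find; lose)
open import Data.List.Membership.Propositional.Properties
open import Data.List.Relation.Unary.All as All using (All; []; _∷_)
import Data.List.Relation.Unary.All.Properties as All
open import Data.List.Relation.Unary.AllPairs using ([]; _∷_)
open import Data.List.Relation.Unary.Any using (here; there; any?)
open import Data.List.Relation.Unary.Linked as Linked using (Linked; [-]; _∷_)
open import Data.List.Relation.Unary.Unique.Propositional using (Unique)
import Data.List.Relation.Unary.Unique.Propositional.Properties as Unique
open import Data.Nat.Base as ℕ using (ℕ; zero; suc; NonZero; _≤_; _<_; _+_; _*_; _∸_; z≤n; s≤s; z<s)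
import Data.Nat.Divisibility as ℕ
open import Data.Nat.DivMod as ℕ using (_%_; m<n⇒m%n≡m; m%n<n; n%n≡0)
open import Data.Nat.Induction using (<-rec)
open import Data.Nat.ListAction using (sum)
open import Data.Nat.ListAction.Properties using (sum-++)
import Data.Nat.Properties as ℕ
import Data.Nat.Tactic.RingSolver as ℕ
open import Data.Product using (∃; ∃-syntax; _×_; _,_; proj₁; proj₂)
open import Data.Product.Properties using (≡-dec)
open import Data.Rational.Base as ℚ using (ℚ; 0ℚ; mkℚ)
import Data.Rational.Properties as ℚ
open import Data.Rational.Solver using (module +-*-Solver)
import Data.Rational.Unnormalised.Base as ℚᵘ
import Data.Rational.Unnormalised.Properties as ℚᵘ
open import Data.Sum.Base using (_⊎_; inj₁; inj₂)
open import Data.Unit.Base using (tt)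
open import Data.Vec.Base as Vec using (Vec; []; _∷_; _++_; lookup; tabulate)
import Data.Vec.Properties as Vec
open import Function.Base using (_∘_; id)
open import Function.Bundles using (_⇔_; mk⇔; module Equivalence)
open import Function.Definitions using (Injective)
open import Level using (0ℓ)
open import Relation.Binary.Bundles using (DecTotalOrder)
open import Relation.Binary.Construct.Closure.Symmetric using (fwd; bwd)
open import Relation.Binary.Core using (Rel)
open import Relation.Binary.Definitions using (DecidableEquality)
open import Relation.Binary.PropositionalEquality
open import Relation.Nullary using (¬_; Dec; yes; no; contradiction; ¬?; _×-dec_; _→-dec_)
open import Relation.Nullary.Decidable using (map′)
open import Relation.Unary using (Pred; _≐_)

open import Data.List.Extrema (DecTotalOrder.totalOrder ℚ.≤-decTotalOrder) using (argmin; argmin-all; f[argmin]≤f[xs])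
open import Algebra.Properties.AbelianGroup ℤ.+-0-abelianGroup using (∙-cancelˡ; ∙-cancelʳ)

open Cut


-- The rungs follow the parity of `i + j`, so an odd translation misplaces them; bars are therefore
-- moved by `2 * t` only. Windows of columns, however, are centred at arbitrary vertices and may
-- begin at either parity, which is one source of the additive errors.
--
-- All estimates are kept as cross-multiplied inequalities in `ℕ`, such as
-- `P * n ≤ Q * count S a n + E`, where `P / Q` is the number of selected vertices per column (`P` a
-- cycle weight, `Q = 2 * p`). The constant `E` must depend neither on the start `a` nor on the
-- width `n`: then the error in the density ratio is small beyond a radius that is the same for all
-- centres. This uniformity is what settles both halves `Below` and `Above` of a cut, and passes
-- through the infimum over vertices, without constructing any limit.
--
-- An arc counts the last two columns of its second barcode, so the weight of a walk lags two blocks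
-- behind its start. For a periodic set the lag is harmless, since any window of a full period has
-- the same count.
--
-- A minimum mean cycle is found by search: arcs are decidable and the length of a cycle is bounded.

-- Finite sums, counting in lists, and integer division

∑ : (ℕ → ℕ) → ℕ → ℕ
∑ f zero    = 0
∑ f (suc n) = ∑ f n + f n

∑-cong : ∀ {f g : ℕ → ℕ} n → (∀ m → m < n → f m ≡ g m) → ∑ f n ≡ ∑ g n
∑-cong zero    eq = refl
∑-cong (suc n) eq = cong₂ _+_ (∑-cong n (λ m m<n → eq m (ℕ.m<n⇒m<1+n m<n))) (eq n ℕ.≤-refl)

∑-suc : ∀ (f : ℕ → ℕ) n → ∑ f (suc n) ≡ f 0 + ∑ (f ∘ suc) n
∑-suc f zero    = ℕ.+-comm 0 (f 0)
∑-suc f (suc n) = trans (cong (_+ f (suc n)) (∑-suc f n)) (ℕ.+-assoc (f 0) _ _)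

∑-+ : ∀ (f : ℕ → ℕ) m n → ∑ f (m + n) ≡ ∑ f m + ∑ (λ i → f (m + i)) n
∑-+ f m zero    = trans (cong (∑ f) (ℕ.+-identityʳ m)) (sym (ℕ.+-identityʳ _))
∑-+ f m (suc n) = begin
  ∑ f (m + suc n)                                ≡⟨ cong (∑ f) (ℕ.+-suc m n) ⟩
  ∑ f (m + n) + f (m + n)                        ≡⟨ cong (_+ f (m + n)) (∑-+ f m n) ⟩
  ∑ f m + ∑ (λ i → f (m + i)) n + f (m + n)      ≡⟨ ℕ.+-assoc (∑ f m) _ _ ⟩
  ∑ f m + (∑ (λ i → f (m + i)) n + f (m + n))    ∎
  where open ≡-Reasoning

∑-tabulate : ∀ (f : ℕ → ℕ) n → Vec.sum (tabulate {n = n} (f ∘ toℕ)) ≡ ∑ f n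
∑-tabulate f zero    = refl
∑-tabulate f (suc n) = trans (cong (f 0 ℕ.+_) (∑-tabulate (f ∘ suc) n)) (sym (∑-suc f n))

-- Deleting the head of `xs` from `ys` keeps the inclusion of the tail, because the head does not
-- recur there. Bounds on simple paths, cycles and balls all go through this count.
Unique-⊆⇒length≤ : ∀ {A : Set} {xs ys : List A} → Unique xs → (∀ {x} → x ∈ xs → x ∈ ys) → length xs ≤ length ys
Unique-⊆⇒length≤ [] _ = z≤n
Unique-⊆⇒length≤ {xs = x ∷ xs} (x∉ ∷ u) xs⊆ with ∈-∃++ (xs⊆ (here refl))
... | as , bs , refl = begin
  suc (length xs)                ≤⟨ s≤s (Unique-⊆⇒length≤ u drop-x) ⟩
  suc (length (as List.++ bs))   ≡⟨ cong suc (List.length-++ as) ⟩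
  suc (length as + length bs)    ≡⟨ ℕ.+-suc (length as) (length bs) ⟨
  length as + suc (length bs)    ≡⟨ List.length-++ as ⟨
  length (as List.++ x ∷ bs)     ∎
  where
  open ℕ.≤-Reasoning
  drop-x : ∀ {y} → y ∈ xs → y ∈ as List.++ bs
  drop-x y∈ with ∈-++⁻ as (xs⊆ (there y∈))
  ... | inj₁ y∈as         = ∈-++⁺ˡ y∈as
  ... | inj₂ (here refl)  = contradiction refl (All.lookup x∉ y∈)
  ... | inj₂ (there y∈bs) = ∈-++⁺ʳ as y∈bs

ℤ-constant : ∀ {A : Set} (f : ℤ → A) → (∀ t → f (t ℤ.+ 1ℤ) ≡ f t) → ∀ t → f t ≡ f 0ℤ
ℤ-constant f step (+ zero)      = refl
ℤ-constant f step (+ suc n)     = trans (trans (cong f (ℤ.+-comm 1ℤ (+ n))) (step (+ n))) (ℤ-constant f step (+ n))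
ℤ-constant f step -[1+ zero ]   = sym (step -1ℤ)
ℤ-constant f step -[1+ suc n ]  = trans (sym (step -[1+ suc n ])) (ℤ-constant f step -[1+ n ])

module _ {d r : ℕ} .{{_ : NonZero d}} (q : ℤ) (r<d : r < d) where

  private
    -- A larger quotient adds at least `d`, more than a remainder `a < d` can make up for. Used in
    -- both directions, this makes the quotient unique.
    below : ∀ {a b} {q q′ : ℤ} → + a ℤ.+ q ℤ.* + d ≡ + b ℤ.+ q′ ℤ.* + d → a < d → q′ ℤ.≤ q
    below {a} {b} {q} {q′} eq a<d = ℤ.≮⇒≥ λ q<q′ → ℤ.<⇒≱ (ℤ.+-monoˡ-< (q ℤ.* + d) (ℤ.+<+ a<d)) (begin
      + d ℤ.+ q ℤ.* + d    ≡⟨ ℤ.suc-* q (+ d) ⟨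
      ℤ.suc q ℤ.* + d      ≤⟨ ℤ.*-monoʳ-≤-nonNeg (+ d) (ℤ.i<j⇒suc[i]≤j q<q′) ⟩
      q′ ℤ.* + d           ≤⟨ ℤ.i≤j+i (q′ ℤ.* + d) (+ b) ⟩
      + b ℤ.+ q′ ℤ.* + d   ≡⟨ eq ⟨
      + a ℤ.+ q ℤ.* + d    ∎)
      where open ℤ.≤-Reasoning

  /ℕ-unique : (+ r ℤ.+ q ℤ.* + d) /ℕ d ≡ q
  /ℕ-unique = ℤ.≤-antisym (below eq r<d) (below (sym eq) (n%ℕd<d n d))
    where
    n  = + r ℤ.+ q ℤ.* + d
    eq = a≡a%ℕn+[a/ℕn]*n n d

  %ℕ-unique : (+ r ℤ.+ q ℤ.* + d) %ℕ d ≡ r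
  %ℕ-unique = ℤ.+-injective (∙-cancelʳ (q ℤ.* + d) _ _ (begin
    + (n %ℕ d) ℤ.+ q ℤ.* + d          ≡⟨ cong (λ z → + (n %ℕ d) ℤ.+ z ℤ.* + d) /ℕ-unique ⟨
    + (n %ℕ d) ℤ.+ (n /ℕ d) ℤ.* + d   ≡⟨ a≡a%ℕn+[a/ℕn]*n n d ⟨
    n                                 ∎))
    where
    open ≡-Reasoning
    n = + r ℤ.+ q ℤ.* + d

-- Locality of the locating-dominating condition

column : ∀ {k} → VertexSet (H k) → ℤ → FS.Subset k
column S j = tabulate λ i → S (i , j)

-- Columns of a bar are numbered from 1, so `B` occupies columns `a + 1` to `a + ℓ` and `a` is the
-- translation that carries the bar into place.
ColumnsAt : ∀ {k ℓ} → VertexSet (H k) → ℤ → Strip k ℓ → Set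
ColumnsAt S a B = ∀ c → lookup B c ≡ column S (a ℤ.+ + suc (toℕ c))

shift : ∀ {k} → ℤ → Fin k × ℤ → Fin k × ℤ
shift a (i , j) = i , a ℤ.+ j

module _ {k : ℕ} where

  open Graph (H k) using (_~_; ~-sym)

  private
    gridEdge-shift : ∀ {a u v} → + 2 ℤ.∣ a → GridEdge k u v → GridEdge k (shift a u) (shift a v)
    gridEdge-shift {a} {i , j} 2∣a (inj₁ (eq , refl)) = inj₁ (eq , sym (ℤ.+-assoc a j 1ℤ))
    gridEdge-shift {a} {i , j} 2∣a (inj₂ (eq , refl , 2∣)) = inj₂ (eq , refl ,
      subst (+ 2 ℤ.∣_) (shuffle a (row i) j) (ℤˢ.∣⇒∣ᵤ (ℤˢ.∣m∣n⇒∣m+n (ℤˢ.∣ᵤ⇒∣ {+ 2} {a} 2∣a) (ℤˢ.∣ᵤ⇒∣ {+ 2} {row i ℤ.+ j} 2∣))))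
      where
      shuffle : ∀ a x j → a ℤ.+ (x ℤ.+ j) ≡ x ℤ.+ (a ℤ.+ j)
      shuffle = ℤ.solve-∀

  -- Whether a rung leaves `(i , j)` depends on the parity of `i + j`, which an even `a` preserves.
  ~-shift : ∀ {a u v} → + 2 ℤ.∣ a → u ~ v → shift a u ~ shift a v
  ~-shift {a} 2∣a (fwd e) = fwd (gridEdge-shift {a} 2∣a e)
  ~-shift {a} 2∣a (bwd e) = bwd (gridEdge-shift {a} 2∣a e)

  ~-unshift : ∀ {a u v} → + 2 ℤ.∣ a → shift a u ~ shift a v → u ~ v
  ~-unshift {a} {u} {v} 2∣a e = subst₂ _~_ (undo u) (undo v)
    (~-shift { ℤ.- a} (subst (2 ℕ.∣_) (sym (ℤ.∣-i∣≡∣i∣ a)) 2∣a) e)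
    where
    cancel : ∀ a j → ℤ.- a ℤ.+ (a ℤ.+ j) ≡ j
    cancel = ℤ.solve-∀
    undo : ∀ u → shift (ℤ.- a) (shift a u) ≡ u
    undo (i , j) = cong (i ,_) (cancel a j)

  ~-columns : ∀ {u v} → u ~ v → (proj₂ v ≡ proj₂ u) ⊎ (proj₂ v ≡ proj₂ u ℤ.+ 1ℤ) ⊎ (proj₂ u ≡ proj₂ v ℤ.+ 1ℤ)
  ~-columns (fwd (inj₁ (_ , eq)))     = inj₂ (inj₁ eq)
  ~-columns (fwd (inj₂ (_ , eq , _))) = inj₁ eq
  ~-columns (bwd (inj₁ (_ , eq)))     = inj₂ (inj₂ eq)
  ~-columns (bwd (inj₂ (_ , eq , _))) = inj₁ (sym eq)

  ~-column≤ : ∀ {u v} → u ~ v → proj₂ v ℤ.≤ proj₂ u ℤ.+ 1ℤ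
  ~-column≤ {_ , j} {_ , j′} e with ~-columns e
  ... | inj₁ refl        = ℤ.i≤i+j j 1ℤ
  ... | inj₂ (inj₁ refl) = ℤ.≤-refl
  ... | inj₂ (inj₂ refl) = ℤ.≤-trans (ℤ.i≤i+j j′ (+ 2)) (ℤ.≤-reflexive (sym (ℤ.+-assoc j′ 1ℤ 1ℤ)))

InnerColumn : ∀ {ℓ} → Fin ℓ → Set
InnerColumn {ℓ} c = 1 < suc (toℕ c) × suc (toℕ c) < ℓ

module _ {k ℓ : ℕ} (S : VertexSet (H k)) (t : ℤ) (B : Strip k ℓ) (at : ColumnsAt S (+ 2 ℤ.* t) B) where

  private
    module H = Graph (H k)
    module R = Graph (Bar k ℓ)
    a = + 2 ℤ.* t
    B∋ : Fin k × Fin ℓ → Set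
    B∋ (i , c) = i FS.∈ lookup B c
    2∣a : + 2 ℤ.∣ a
    2∣a = ℤˢ.∣⇒∣ᵤ (ℤˢ.∣m⇒∣m*n t (ℤˢ.∣-refl {+ 2}))
    place : Fin k × Fin ℓ → Fin k × ℤ
    place u = shift a (inGrid u)

    value : ∀ i c → lookup (lookup B c) i ≡ S (place (i , c))
    value i c = trans (cong (λ x → lookup x i) (at c)) (Vec.lookup∘tabulate _ i)

    into : ∀ {u} → B∋ u → ⟦ S ⟧ (place u)
    into {i , c} i∈ = Equivalence.from T-≡ (trans (sym (value i c)) (Vec.[]=⇒lookup i∈))

    back : ∀ {u} → ⟦ S ⟧ (place u) → B∋ u
    back {i , c} s = Vec.lookup⇒[]= i (lookup B c) (trans (value i c) (Equivalence.to T-≡ s))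

    column-placed : ∀ {i : Fin k} {j} n → n < ℓ → j ≡ a ℤ.+ + suc n → ∃[ y ] place y ≡ (i , j)
    column-placed {i} n n<ℓ refl = (i , fromℕ< n<ℓ) , cong (λ m → i , a ℤ.+ + suc m) (Fin.toℕ-fromℕ< n<ℓ)

    -- Both columns next to an inner column belong to the bar, so the bar contains the whole
    -- neighbourhood of an inner vertex. Hence the traces of `B` and of `S` on such a neighbourhood
    -- agree.
    neighbor-placed : ∀ {i c x} → InnerColumn c → place (i , c) H.~ x → ∃[ y ] place y ≡ x
    neighbor-placed {i} {c} {_ , j} (_ , c+1<ℓ) e with ~-columns e
    ... | inj₁ eq        = column-placed (toℕ c) (ℕ.<-trans (ℕ.n<1+n _) c+1<ℓ) eq
    ... | inj₂ (inj₁ eq) = column-placed (suc (toℕ c)) c+1<ℓ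
      (trans eq (trans (ℤ.+-assoc a _ 1ℤ) (cong (ℤ._+_ a) (cong +_ (ℕ.+-comm (suc (toℕ c)) 1)))))
    neighbor-placed {i} {suc c} {_ , j} (_ , c+1<ℓ) e | inj₂ (inj₂ eq) =
      column-placed (toℕ c) (ℕ.<-trans (ℕ.n<1+n _) (ℕ.<-trans (ℕ.n<1+n _) c+1<ℓ))
        (trans (predecessor j) (trans (cong (ℤ._+ -1ℤ) (sym eq)) (ℤ.+-assoc a _ -1ℤ)))
      where
      predecessor : ∀ j → j ≡ j ℤ.+ 1ℤ ℤ.+ -1ℤ
      predecessor = ℤ.solve-∀
    neighbor-placed {i} {zero} (s≤s () , _) e | inj₂ (inj₂ eq)

    place-injective : ∀ {u v} → place u ≡ place v → u ≡ v
    place-injective {i , c} {i′ , c′} eq = cong₂ _,_ (cong proj₁ eq)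
      (Fin.toℕ-injective (ℕ.suc-injective (ℤ.+-injective (∙-cancelˡ a _ _ (cong proj₂ eq)))))

  LDS⇒barcode : IsLDS (H k) S → IsBarcode B
  LDS⇒barcode (dominating , separating) = dom , sep
    where
    dom : ∀ v → InnerColumn (proj₂ v) → ¬ B∋ v → ∃[ y ] v R.~ y × B∋ y
    dom v inner v∉ with dominating (place v) tt (v∉ ∘ back)
    ... | x , e , s with neighbor-placed inner e
    ... | y , refl = y , ~-unshift {a = a} 2∣a e , back s

    half : ∀ {u v} → InnerColumn (proj₂ u) → (∀ {y} → u R.~ y × B∋ y → v R.~ y × B∋ y) →
           ∀ {x} → place u H.~ x × ⟦ S ⟧ x → place v H.~ x × ⟦ S ⟧ x
    half inner f (e , s) with neighbor-placed inner e
    ... | y , refl with f (~-unshift {a = a} 2∣a e , back s)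
    ... | e′ , y∈ = ~-shift {a = a} 2∣a e′ , into y∈

    sep : ∀ u v → InnerColumn (proj₂ u) → InnerColumn (proj₂ v) → ¬ B∋ u → ¬ B∋ v → u ≢ v → _
    sep u v iu iv u∉ v∉ u≢v (f , g) =
      separating (place u) (place v) tt tt (u∉ ∘ back) (v∉ ∘ back) (u≢v ∘ place-injective) (half iu f , half iv g)

  module _ (barcode : IsBarcode B) where

    dominates : ∀ {x} y → InnerColumn (proj₂ y) → place y ≡ x → ¬ ⟦ S ⟧ x → ∃[ z ] x H.~ z × ⟦ S ⟧ z
    dominates y inner refl y∉ with proj₁ barcode y inner (y∉ ∘ into)
    ... | z , e , z∈ = place z , ~-shift {a = a} 2∣a e , into z∈

    separates : ∀ {x x′} y y′ → InnerColumn (proj₂ y) → InnerColumn (proj₂ y′) → place y ≡ x → place y′ ≡ x′ →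
                ¬ ⟦ S ⟧ x → ¬ ⟦ S ⟧ x′ → x ≢ x′ →
                (∀ {z} → x H.~ z × ⟦ S ⟧ z → x′ H.~ z × ⟦ S ⟧ z) →
                (∀ {z} → x′ H.~ z × ⟦ S ⟧ z → x H.~ z × ⟦ S ⟧ z) → ⊥
    separates y y′ iy iy′ refl refl y∉ y′∉ y≢y′ f g =
      proj₂ barcode y y′ iy iy′ (y∉ ∘ into) (y′∉ ∘ into) (y≢y′ ∘ cong place) (half f , half g)
      where
      half : ∀ {u v} → (∀ {z} → place u H.~ z × ⟦ S ⟧ z → place v H.~ z × ⟦ S ⟧ z) →
             ∀ {y} → u R.~ y × B∋ y → v R.~ y × B∋ y
      half f (e , y∈) with f (~-shift {a = a} 2∣a e , into y∈)
      ... | e′ , s = ~-unshift {a = a} 2∣a e′ , back s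

-- Two vertices with a common neighbour are at most two columns apart, and
-- every two such columns are inner columns of one of the 6-bars that start
-- after an even column.
inner-columns : ∀ j d → d ≤ 2 → ∃[ t ] ∃[ c ] ∃[ c′ ] InnerColumn {6} c × InnerColumn {6} c′
  × + 2 ℤ.* t ℤ.+ + suc (toℕ c) ≡ j × + 2 ℤ.* t ℤ.+ + suc (toℕ c′) ≡ j ℤ.+ + d
inner-columns j d d≤2 = q ℤ.- 1ℤ , fromℕ< c<6 , fromℕ< c′<6 , inner (1 + r) c<6 (s≤s z≤n) (s≤s (ℕ.≤-trans r≤1 (s≤s z≤n)))
  , inner (1 + r + d) c′<6 (s≤s z≤n) (s≤s (ℕ.+-mono-≤ r≤1 d≤2))
  , trans (cong (λ m → + 2 ℤ.* (q ℤ.- 1ℤ) ℤ.+ + suc m) (Fin.toℕ-fromℕ< c<6)) at-c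
  , trans (cong (λ m → + 2 ℤ.* (q ℤ.- 1ℤ) ℤ.+ + suc m) (Fin.toℕ-fromℕ< c′<6))
      (trans (sym (ℤ.+-assoc (+ 2 ℤ.* (q ℤ.- 1ℤ)) (+ suc (1 + r)) (+ d))) (cong (ℤ._+ + d) at-c))
  where
  -- As `j = r + 2q`, the bar that starts after column `2(q - 1)` has `j` as its column number
  -- `2 + r`, with index `1 + r` equal to 1 or 2. Adding `d ≤ 2` reaches at most index 4, the last
  -- inner one.
  q = j /ℕ 2
  r = j %ℕ 2
  r≤1 : r ≤ 1
  r≤1 = ℕ.≤-pred (n%ℕd<d j 2)
  c<6 : 1 + r < 6
  c<6 = s≤s (s≤s (ℕ.≤-trans r≤1 (s≤s z≤n)))
  c′<6 : 1 + r + d < 6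
  c′<6 = s≤s (s≤s (ℕ.≤-trans (ℕ.+-mono-≤ r≤1 d≤2) (ℕ.n≤1+n 3)))
  inner : ∀ c c<6 → 1 ≤ c → c ≤ 4 → InnerColumn {6} (fromℕ< {c} c<6)
  inner c c<6 1≤c c≤4 rewrite Fin.toℕ-fromℕ< c<6 = s≤s 1≤c , s≤s (s≤s c≤4)
  identity : ∀ q r → + 2 ℤ.* (q ℤ.- 1ℤ) ℤ.+ (+ 2 ℤ.+ r) ≡ r ℤ.+ q ℤ.* + 2
  identity = ℤ.solve-∀
  at-c : + 2 ℤ.* (q ℤ.- 1ℤ) ℤ.+ + suc (1 + r) ≡ j
  at-c = trans (identity q (+ r)) (sym (a≡a%ℕn+[a/ℕn]*n j 2))

module _ {k : ℕ} (S : VertexSet (H k))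
         (bars : ∀ t → ∃[ B ] ColumnsAt {ℓ = 6} S (+ 2 ℤ.* t) B × IsBarcode B) where

  private
    open Graph (H k)

    dominating : ∀ v → ¬ ⟦ S ⟧ v → ∃[ x ] v ~ x × ⟦ S ⟧ x
    dominating (i , j) v∉ with inner-columns j 0 z≤n
    ... | t , c , _ , inner , _ , eq , _ with bars t
    ... | B , at , barcode = dominates S t B at barcode (i , c) inner (cong (i ,_) eq) v∉

    -- Domination gives `u` a selected neighbour `x`, and equality of the traces makes `x` a
    -- neighbour of `v` as well. So the columns of `u` and `v` differ by at most 2, and a single bar
    -- has both as inner vertices and separates them.
    separating : ∀ {u v} → proj₂ u ℤ.≤ proj₂ v → ¬ ⟦ S ⟧ u → ¬ ⟦ S ⟧ v → u ≢ v →
                 (∀ {x} → u ~ x × ⟦ S ⟧ x → v ~ x × ⟦ S ⟧ x) → (∀ {x} → v ~ x × ⟦ S ⟧ x → u ~ x × ⟦ S ⟧ x) → ⊥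
    separating {i , j} {i′ , j′} j≤j′ u∉ v∉ u≢v f g with dominating (i , j) u∉
    ... | x , e , x∈ with inner-columns j d d≤2
      where
      d = ℤ.∣ j′ ℤ.- j ∣
      +d≡ : + d ≡ j′ ℤ.- j
      +d≡ = ℤ.0≤i⇒+∣i∣≡i (ℤ.i≤j⇒0≤j-i j≤j′)
      j′≤ : j′ ℤ.≤ j ℤ.+ 1ℤ ℤ.+ 1ℤ
      j′≤ = ℤ.≤-trans (~-column≤ (~-sym (proj₁ (f (e , x∈))))) (ℤ.+-monoˡ-≤ 1ℤ (~-column≤ e))
      identity : ∀ j → j ℤ.+ 1ℤ ℤ.+ 1ℤ ℤ.- j ≡ + 2
      identity = ℤ.solve-∀
      d≤2 : d ≤ 2
      d≤2 = ℤ.drop‿+≤+ (subst₂ ℤ._≤_ (sym +d≡) (identity j) (ℤ.+-monoˡ-≤ (ℤ.- j) j′≤))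
    ... | t , c , c′ , ic , ic′ , eq , eq′ with bars t
    ... | B , at , barcode = separates S t B at barcode (i , c) (i′ , c′) ic ic′ (cong (i ,_) eq)
      (cong (i′ ,_) (trans eq′ (trans (cong (ℤ._+_ j) (ℤ.0≤i⇒+∣i∣≡i (ℤ.i≤j⇒0≤j-i j≤j′))) (identity j j′)))) u∉ v∉ u≢v f g
      where
      identity : ∀ j j′ → j ℤ.+ (j′ ℤ.- j) ≡ j′
      identity = ℤ.solve-∀

  barcodes⇒LDS : IsLDS (H k) S
  barcodes⇒LDS = (λ v _ → dominating v) , sep
    where
    sep : ∀ u v → _ → _ → _
    sep u v _ _ u∉ v∉ u≢v (f , g) with ℤ.≤-total (proj₂ u) (proj₂ v)
    ... | inj₁ u≤v = separating u≤v u∉ v∉ u≢v f g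
    ... | inj₂ v≤u = separating v≤u v∉ u∉ (u≢v ∘ sym) g f

-- Closed walks and periodic sets

-- Both parts are compared with one function of the column number, so that a block and the strip
-- after it can be glued without casts between `Fin` types.
lookup-++-via : ∀ {A : Set} {m n} (xs : Vec A m) (ys : Vec A n) (f : ℕ → A) →
  (∀ c → lookup xs c ≡ f (toℕ c)) → (∀ c → lookup ys c ≡ f (m + toℕ c)) → ∀ c → lookup (xs ++ ys) c ≡ f (toℕ c)
lookup-++-via []       ys f eq eq′ c       = eq′ c
lookup-++-via (x ∷ xs) ys f eq eq′ zero    = eq zero
lookup-++-via (x ∷ xs) ys f eq eq′ (suc c) = lookup-++-via xs ys (f ∘ suc) (eq ∘ suc) eq′ c

lookup-ext : ∀ {A : Set} {n} {xs ys : Vec A n} → (∀ c → lookup xs c ≡ lookup ys c) → xs ≡ ys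
lookup-ext {xs = xs} {ys} eq = trans (sym (Vec.tabulate∘lookup xs)) (trans (Vec.tabulate-cong eq) (Vec.tabulate∘lookup ys))

HasBlocks : ∀ {k} → VertexSet (H k) → (ℤ → Strip k 2) → Set
HasBlocks S X = ∀ t → ColumnsAt S (+ 2 ℤ.* t) (X t)

block : ∀ {k} → VertexSet (H k) → ℤ → Strip k 2
block S t = tabulate λ c → column S (+ 2 ℤ.* t ℤ.+ + suc (toℕ c))

code : ∀ {k} → VertexSet (H k) → ℤ → Code k
code S t = block S t , block S (t ℤ.+ 1ℤ)

module _ {k : ℕ} (S : VertexSet (H k)) where

  block-hasBlocks : HasBlocks S (block S)
  block-hasBlocks t c = Vec.lookup∘tabulate (λ c → column S (+ 2 ℤ.* t ℤ.+ + suc (toℕ c))) c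

  columnsAt-block-++ : ∀ {n} t {B : Strip k n} → ColumnsAt S (+ 2 ℤ.* (t ℤ.+ 1ℤ)) B → ColumnsAt S (+ 2 ℤ.* t) (block S t ++ B)
  columnsAt-block-++ t {B} at = lookup-++-via (block S t) B (λ m → column S (+ 2 ℤ.* t ℤ.+ + suc m)) (block-hasBlocks t)
    λ c → trans (at c) (cong (column S) (identity t (+ suc (toℕ c))))
    where
    identity : ∀ t x → + 2 ℤ.* (t ℤ.+ 1ℤ) ℤ.+ x ≡ + 2 ℤ.* t ℤ.+ (+ 2 ℤ.+ x)
    identity = ℤ.solve-∀

  columnsAt-4 : ∀ t → ColumnsAt S (+ 2 ℤ.* t) (block S t ++ block S (t ℤ.+ 1ℤ))
  columnsAt-4 t = columnsAt-block-++ t (block-hasBlocks (t ℤ.+ 1ℤ))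

  columnsAt-6 : ∀ t → ColumnsAt S (+ 2 ℤ.* t) (block S t ++ block S (t ℤ.+ 1ℤ) ++ block S (t ℤ.+ 1ℤ ℤ.+ 1ℤ))
  columnsAt-6 t = columnsAt-block-++ t (columnsAt-4 (t ℤ.+ 1ℤ))

  LDS⇒arc : IsLDS (H k) S → ∀ t → Arc (code S t) (code S (t ℤ.+ 1ℤ))
  LDS⇒arc lds t = LDS⇒barcode S t (block S t ++ block S (t ℤ.+ 1ℤ)) (columnsAt-4 t) lds
                , LDS⇒barcode S (t ℤ.+ 1ℤ) (block S (t ℤ.+ 1ℤ) ++ block S (t ℤ.+ 1ℤ ℤ.+ 1ℤ)) (columnsAt-4 (t ℤ.+ 1ℤ)) lds
                , refl
                , LDS⇒barcode S t (block S t ++ block S (t ℤ.+ 1ℤ) ++ block S (t ℤ.+ 1ℤ ℤ.+ 1ℤ)) (columnsAt-6 t) lds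

  arcs⇒LDS : (∀ t → Arc (code S t) (code S (t ℤ.+ 1ℤ))) → IsLDS (H k) S
  arcs⇒LDS arcs = barcodes⇒LDS S λ t → block S t ++ block S (t ℤ.+ 1ℤ) ++ block S (t ℤ.+ 1ℤ ℤ.+ 1ℤ) , columnsAt-6 t , proj₂ (proj₂ (proj₂ (arcs t)))

  -- Block `t` holds columns `2t + 1` and `2t + 2`, so it is `j - 1`, not `j`, that is divided by 2.
  column-split : ∀ j → + 2 ℤ.* ((j ℤ.- 1ℤ) /ℕ 2) ℤ.+ + suc (toℕ (fromℕ< (n%ℕd<d (j ℤ.- 1ℤ) 2))) ≡ j
  column-split j = begin
    + 2 ℤ.* q ℤ.+ + suc (toℕ (fromℕ< (n%ℕd<d n 2)))  ≡⟨ cong (λ r → + 2 ℤ.* q ℤ.+ + suc r) (Fin.toℕ-fromℕ< (n%ℕd<d n 2)) ⟩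
    + 2 ℤ.* q ℤ.+ (1ℤ ℤ.+ + (n %ℕ 2))                 ≡⟨ shuffle q (+ (n %ℕ 2)) ⟩
    + (n %ℕ 2) ℤ.+ q ℤ.* + 2 ℤ.+ 1ℤ                    ≡⟨ cong (ℤ._+ 1ℤ) (a≡a%ℕn+[a/ℕn]*n n 2) ⟨
    j ℤ.- 1ℤ ℤ.+ 1ℤ                                   ≡⟨ cancel j ⟩
    j                                                ∎
    where
    open ≡-Reasoning
    n = j ℤ.- 1ℤ
    q = n /ℕ 2
    shuffle : ∀ q r → + 2 ℤ.* q ℤ.+ (1ℤ ℤ.+ r) ≡ r ℤ.+ q ℤ.* + 2 ℤ.+ 1ℤ
    shuffle = ℤ.solve-∀
    cancel : ∀ j → j ℤ.- 1ℤ ℤ.+ 1ℤ ≡ j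
    cancel = ℤ.solve-∀

  lookup-block : ∀ i j → lookup (lookup (block S ((j ℤ.- 1ℤ) /ℕ 2)) (fromℕ< (n%ℕd<d (j ℤ.- 1ℤ) 2))) i ≡ S (i , j)
  lookup-block i j = trans
    (cong (λ x → lookup x i) (trans (block-hasBlocks ((j ℤ.- 1ℤ) /ℕ 2) (fromℕ< (n%ℕd<d (j ℤ.- 1ℤ) 2))) (cong (column S) (column-split j))))
    (Vec.lookup∘tabulate _ i)

  hasBlocks⇒block : ∀ X → HasBlocks S X → ∀ t → X t ≡ block S t
  hasBlocks⇒block X at t = lookup-ext λ c → trans (at t c) (sym (block-hasBlocks t c))

  SameWindow : ℕ → ℕ → Set
  SameWindow m n = ∀ (i : Fin k) (c : Fin 4) → S (i , + (2 * m + suc (toℕ c))) ≡ S (i , + (2 * n + suc (toℕ c)))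

  private
    window : ∀ m (c : Fin 4) → lookup (block S (+ m) ++ block S (+ m ℤ.+ 1ℤ)) c ≡ column S (+ (2 * m + suc (toℕ c)))
    window m c = trans (columnsAt-4 (+ m) c) (cong (λ z → column S (z ℤ.+ + suc (toℕ c))) (sym (ℤ.pos-* 2 m)))

  sameWindow⇒code≡ : ∀ m n → SameWindow m n → code S (+ m) ≡ code S (+ n)
  sameWindow⇒code≡ m n same with Vec.++-injective (block S (+ m)) (block S (+ n))
    (lookup-ext λ c → trans (window m c) (trans (Vec.tabulate-cong λ i → same i c) (sym (window n c))))
  ... | eq , eq′ = cong₂ _,_ eq eq′

  code≡⇒sameWindow : ∀ m n → code S (+ m) ≡ code S (+ n) → SameWindow m n
  code≡⇒sameWindow m n eq i c = begin
    S (i , + (2 * m + suc (toℕ c)))                          ≡⟨ Vec.lookup∘tabulate _ i ⟨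
    lookup (column S (+ (2 * m + suc (toℕ c)))) i            ≡⟨ cong (λ x → lookup x i) (trans (sym (window m c))
                                                                  (trans (cong (λ (x , y) → lookup (x ++ y) c) eq) (window n c))) ⟩
    lookup (column S (+ (2 * n + suc (toℕ c)))) i            ≡⟨ Vec.lookup∘tabulate _ i ⟩
    S (i , + (2 * n + suc (toℕ c)))                          ∎
    where open ≡-Reasoning

module _ (p : ℕ) .{{_ : NonZero p}} where

  residue : ℤ → Fin p
  residue t = fromℕ< (n%ℕd<d t p)

  toℕ-residue : ∀ t → toℕ (residue t) ≡ t %ℕ p
  toℕ-residue t = Fin.toℕ-fromℕ< (n%ℕd<d t p)

  residue-toℕ : ∀ m → residue (+ toℕ m) ≡ m
  residue-toℕ m = Fin.toℕ-injective (trans (toℕ-residue (+ toℕ m)) (m<n⇒m%n≡m (Fin.toℕ<n m)))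

  private
    residue-unique : ∀ {t r} q → r < p → t ≡ + r ℤ.+ q ℤ.* + p → toℕ (residue t) ≡ r
    residue-unique {r = r} q r<p refl = trans (toℕ-residue (+ r ℤ.+ q ℤ.* + p)) (%ℕ-unique q r<p)

  residue-+p : ∀ t → residue (t ℤ.+ + p) ≡ residue t
  residue-+p t = Fin.toℕ-injective (trans (residue-unique (t /ℕ p ℤ.+ 1ℤ) (n%ℕd<d t p) (begin
    t ℤ.+ + p                                    ≡⟨ cong (ℤ._+ + p) (a≡a%ℕn+[a/ℕn]*n t p) ⟩
    + (t %ℕ p) ℤ.+ (t /ℕ p) ℤ.* + p ℤ.+ + p      ≡⟨ identity (+ (t %ℕ p)) (t /ℕ p) (+ p) ⟩
    + (t %ℕ p) ℤ.+ (t /ℕ p ℤ.+ 1ℤ) ℤ.* + p       ∎)) (sym (toℕ-residue t)))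
    where
    open ≡-Reasoning
    identity : ∀ r q p → r ℤ.+ q ℤ.* p ℤ.+ p ≡ r ℤ.+ (q ℤ.+ 1ℤ) ℤ.* p
    identity = ℤ.solve-∀

  -- A wrap from `p - 1` to `0` is absorbed by the quotient. The value of `next` does not depend on
  -- the implicit number of rows, so the instance at `0` serves every `k`.
  residue-suc : ∀ t → residue (t ℤ.+ 1ℤ) ≡ next {0} (residue t)
  residue-suc t = Fin.toℕ-injective (trans (residue-unique (q ℤ.+ s /ℕ p) (n%ℕd<d s p) (begin
    t ℤ.+ 1ℤ                                            ≡⟨ cong (ℤ._+ 1ℤ) (a≡a%ℕn+[a/ℕn]*n t p) ⟩
    + (t %ℕ p) ℤ.+ q ℤ.* + p ℤ.+ 1ℤ                      ≡⟨ cong (λ r → + r ℤ.+ q ℤ.* + p ℤ.+ 1ℤ) (toℕ-residue t) ⟨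
    + toℕ (residue t) ℤ.+ q ℤ.* + p ℤ.+ 1ℤ               ≡⟨ shuffle (+ toℕ (residue t)) q (+ p) ⟩
    s ℤ.+ q ℤ.* + p                                     ≡⟨ cong (ℤ._+ q ℤ.* + p) (a≡a%ℕn+[a/ℕn]*n s p) ⟩
    + (s %ℕ p) ℤ.+ (s /ℕ p) ℤ.* + p ℤ.+ q ℤ.* + p        ≡⟨ identity (+ (s %ℕ p)) (s /ℕ p) (+ p) q ⟩
    + (s %ℕ p) ℤ.+ (q ℤ.+ s /ℕ p) ℤ.* + p                ∎)) (sym (Fin.toℕ-fromℕ< (m%n<n (suc (toℕ (residue t))) p))))
    where
    open ≡-Reasoning
    q = t /ℕ p
    s = + suc (toℕ (residue t))
    shuffle : ∀ r q p → r ℤ.+ q ℤ.* p ℤ.+ 1ℤ ≡ 1ℤ ℤ.+ r ℤ.+ q ℤ.* p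
    shuffle = ℤ.solve-∀
    identity : ∀ r q p q′ → r ℤ.+ q ℤ.* p ℤ.+ q′ ℤ.* p ≡ r ℤ.+ (q′ ℤ.+ q) ℤ.* p
    identity = ℤ.solve-∀

  -- Along the residue class of `t`, `f` is constant as a function of the quotient, and `ℤ-constant`
  -- takes the quotient to `0`.
  periodic-%ℕ : ∀ {A : Set} (f : ℤ → A) → (∀ t → f (t ℤ.+ + p) ≡ f t) → ∀ t → f (+ (t %ℕ p)) ≡ f t
  periodic-%ℕ f per t = sym (begin
    f t                                           ≡⟨ cong f (a≡a%ℕn+[a/ℕn]*n t p) ⟩
    f (+ (t %ℕ p) ℤ.+ (t /ℕ p) ℤ.* + p)           ≡⟨ ℤ-constant (λ q → f (+ (t %ℕ p) ℤ.+ q ℤ.* + p)) step (t /ℕ p) ⟩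
    f (+ (t %ℕ p) ℤ.+ 0ℤ ℤ.* + p)                 ≡⟨ cong f (identity₀ (+ (t %ℕ p)) (+ p)) ⟩
    f (+ (t %ℕ p))                                ∎)
    where
    open ≡-Reasoning
    identity₀ : ∀ r p → r ℤ.+ 0ℤ ℤ.* p ≡ r
    identity₀ = ℤ.solve-∀
    identity : ∀ r q p → r ℤ.+ (q ℤ.+ 1ℤ) ℤ.* p ≡ r ℤ.+ q ℤ.* p ℤ.+ p
    identity = ℤ.solve-∀
    step : ∀ q → f (+ (t %ℕ p) ℤ.+ (q ℤ.+ 1ℤ) ℤ.* + p) ≡ f (+ (t %ℕ p) ℤ.+ q ℤ.* + p)
    step q = trans (cong f (identity (+ (t %ℕ p)) q (+ p))) (per _)

module _ {k p : ℕ} .{{_ : NonZero p}} where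

  module _ (C : Vec (Code k) p) where

    private
      X : ℤ → Strip k 2
      X t = proj₁ (at C (residue p t))

    S[]-hasBlocks : HasBlocks S[ C ] X
    S[]-hasBlocks t c = trans (sym (Vec.tabulate∘lookup (lookup (X t) c))) (Vec.tabulate-cong value)
      where
      n = + 2 ℤ.* t ℤ.+ + suc (toℕ c) ℤ.- 1ℤ
      identity : ∀ t c → + 2 ℤ.* t ℤ.+ (1ℤ ℤ.+ c) ℤ.- 1ℤ ≡ c ℤ.+ t ℤ.* + 2
      identity = ℤ.solve-∀
      n≡ : n ≡ + toℕ c ℤ.+ t ℤ.* + 2
      n≡ = identity t (+ toℕ c)
      n/2≡t : n /ℕ 2 ≡ t
      n/2≡t = trans (cong (_/ℕ 2) n≡) (/ℕ-unique t (Fin.toℕ<n c))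
      n%2≡c : fromℕ< (n%ℕd<d n 2) ≡ c
      n%2≡c = Fin.toℕ-injective (trans (Fin.toℕ-fromℕ< (n%ℕd<d n 2)) (trans (cong (_%ℕ 2) n≡) (%ℕ-unique t (Fin.toℕ<n c))))
      value : ∀ i → lookup (lookup (X t) c) i ≡ S[ C ] (i , + 2 ℤ.* t ℤ.+ + suc (toℕ c))
      value i = sym (cong₂ (λ t c → lookup (lookup (X t) c) i) n/2≡t n%2≡c)

    -- A shift by `2 * p` columns raises the block number by `p`, leaving its residue unchanged, and
    -- keeps the position inside the block.
    S[]-period : HasPeriod S[ C ] (2 * p)
    S[]-period = 1≤2p , λ i j → sym (trans (sym (lookup-block S[ C ] i (j ℤ.+ + (2 * p)))) (trans (shifted i j) (lookup-block S[ C ] i j)))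
      where
      1≤2p : 1 ≤ 2 * p
      1≤2p = ℕ.≤-trans (ℕ.>-nonZero⁻¹ p) (ℕ.m≤n*m p 2)
      identity : ∀ j p r q → j ≡ r ℤ.+ q ℤ.* + 2 → j ℤ.+ + 2 ℤ.* p ≡ r ℤ.+ (q ℤ.+ p) ℤ.* + 2
      identity _ p r q refl = lemma p r q
        where
        lemma : ∀ p r q → r ℤ.+ q ℤ.* + 2 ℤ.+ + 2 ℤ.* p ≡ r ℤ.+ (q ℤ.+ p) ℤ.* + 2
        lemma = ℤ.solve-∀
      swap : ∀ j p → j ℤ.+ p ℤ.- 1ℤ ≡ j ℤ.- 1ℤ ℤ.+ p
      swap = ℤ.solve-∀
      module _ (j : ℤ) where
        n  = j ℤ.- 1ℤ
        n′ = j ℤ.+ + (2 * p) ℤ.- 1ℤ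
        n′≡ : n′ ≡ + (n %ℕ 2) ℤ.+ (n /ℕ 2 ℤ.+ + p) ℤ.* + 2
        n′≡ = trans (swap j (+ (2 * p))) (trans (cong (ℤ._+_ n) (ℤ.pos-* 2 p)) (identity n (+ p) (+ (n %ℕ 2)) (n /ℕ 2) (a≡a%ℕn+[a/ℕn]*n n 2)))
        div≡ : n′ /ℕ 2 ≡ n /ℕ 2 ℤ.+ + p
        div≡ = trans (cong (_/ℕ 2) n′≡) (/ℕ-unique (n /ℕ 2 ℤ.+ + p) (n%ℕd<d n 2))
        mod≡ : fromℕ< (n%ℕd<d n′ 2) ≡ fromℕ< (n%ℕd<d n 2)
        mod≡ = Fin.fromℕ<-cong _ _ (trans (cong (_%ℕ 2) n′≡) (%ℕ-unique (n /ℕ 2 ℤ.+ + p) (n%ℕd<d n 2))) _ _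
        block≡ : block S[ C ] (n′ /ℕ 2) ≡ block S[ C ] (n /ℕ 2)
        block≡ = begin
          block S[ C ] (n′ /ℕ 2)          ≡⟨ cong (block S[ C ]) div≡ ⟩
          block S[ C ] (n /ℕ 2 ℤ.+ + p)   ≡⟨ hasBlocks⇒block S[ C ] X S[]-hasBlocks (n /ℕ 2 ℤ.+ + p) ⟨
          X (n /ℕ 2 ℤ.+ + p)              ≡⟨ cong (λ m → proj₁ (at C m)) (residue-+p p (n /ℕ 2)) ⟩
          X (n /ℕ 2)                      ≡⟨ hasBlocks⇒block S[ C ] X S[]-hasBlocks (n /ℕ 2) ⟩
          block S[ C ] (n /ℕ 2)           ∎
          where open ≡-Reasoning
      shifted : ∀ i j → _ ≡ _
      shifted i j = cong₂ (λ B c → lookup (lookup B c) i) (block≡ j) (mod≡ j)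

    module _ (walk : IsClosedWalk C) where

      -- `S[ C ]` is assembled from the left halves only. The condition `Y ≡ X′` in each arc
      -- identifies a right half with the next left half, so the whole walk can be read back from
      -- the grid.
      closedWalk-code : ∀ t → at C (residue p t) ≡ code S[ C ] t
      closedWalk-code t = cong₂ _,_ (X≡block t) (begin
        proj₂ (at C (residue p t))         ≡⟨ proj₁ (proj₂ (proj₂ (walk (residue p t)))) ⟩
        proj₁ (at C (next {k} (residue p t)))  ≡⟨ cong (λ m → proj₁ (at C m)) (residue-suc p t) ⟨
        X (t ℤ.+ 1ℤ)                       ≡⟨ X≡block (t ℤ.+ 1ℤ) ⟩
        block S[ C ] (t ℤ.+ 1ℤ)            ∎)
        where
        open ≡-Reasoning
        X≡block : ∀ t → X t ≡ block S[ C ] t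
        X≡block = hasBlocks⇒block S[ C ] X S[]-hasBlocks

      closedWalk⇒periodicLDS : IsPeriodicLDS (2 * p) S[ C ]
      closedWalk⇒periodicLDS = arcs⇒LDS S[ C ] arcs , S[]-period
        where
        arcs : ∀ t → Arc (code S[ C ] t) (code S[ C ] (t ℤ.+ 1ℤ))
        arcs t = subst₂ Arc (closedWalk-code t)
          (trans (cong (at C) (sym (residue-suc p t))) (closedWalk-code (t ℤ.+ 1ℤ))) (walk (residue p t))

      cycle⇒distinctWindows : Injective _≡_ _≡_ (at C) → DistinctWindows p S[ C ]
      cycle⇒distinctWindows inj m n same = inj (begin
        at C m                          ≡⟨ cong (at C) (residue-toℕ p m) ⟨
        at C (residue p (+ toℕ m))      ≡⟨ closedWalk-code (+ toℕ m) ⟩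
        code S[ C ] (+ toℕ m)           ≡⟨ sameWindow⇒code≡ S[ C ] (toℕ m) (toℕ n) same ⟩
        code S[ C ] (+ toℕ n)           ≡⟨ closedWalk-code (+ toℕ n) ⟨
        at C (residue p (+ toℕ n))      ≡⟨ cong (at C) (residue-toℕ p n) ⟩
        at C n                          ∎)
        where open ≡-Reasoning

  module _ (S : VertexSet (H k)) (periodic : IsPeriodicLDS (2 * p) S) where

    walkOf : Vec (Code k) p
    walkOf = tabulate λ m → code S (+ toℕ m)

    private
      at-walkOf : ∀ m → at walkOf m ≡ code S (+ toℕ m)
      at-walkOf m = Vec.lookup∘tabulate _ m

      block-period : ∀ t → block S (t ℤ.+ + p) ≡ block S t
      block-period t = Vec.tabulate-cong λ c → Vec.tabulate-cong λ i →
        trans (cong (λ j → S (i , j)) (trans (identity t (+ p) (+ suc (toℕ c))) (cong (ℤ._+_ (+ 2 ℤ.* t ℤ.+ + suc (toℕ c))) (sym (ℤ.pos-* 2 p)))))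
              (sym (proj₂ (proj₂ periodic) i (+ 2 ℤ.* t ℤ.+ + suc (toℕ c))))
        where
        identity : ∀ t p c → + 2 ℤ.* (t ℤ.+ p) ℤ.+ c ≡ + 2 ℤ.* t ℤ.+ c ℤ.+ + 2 ℤ.* p
        identity = ℤ.solve-∀

      code-period : ∀ t → code S (t ℤ.+ + p) ≡ code S t
      code-period t = cong₂ _,_ (block-period t) (trans (cong (block S) (swap t (+ p))) (block-period (t ℤ.+ 1ℤ)))
        where
        swap : ∀ t p → t ℤ.+ p ℤ.+ 1ℤ ≡ t ℤ.+ 1ℤ ℤ.+ p
        swap = ℤ.solve-∀

    walkOf-closed : IsClosedWalk walkOf
    walkOf-closed m = subst₂ Arc (sym (at-walkOf m)) (sym (begin
      at walkOf (next {k} m)                    ≡⟨ at-walkOf (next {k} m) ⟩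
      code S (+ toℕ (next {k} m))               ≡⟨ cong (λ n → code S (+ n)) (Fin.toℕ-fromℕ< (m%n<n (suc (toℕ m)) p)) ⟩
      code S (+ (suc (toℕ m) % p))          ≡⟨ periodic-%ℕ p (code S) code-period (+ suc (toℕ m)) ⟩
      code S (+ suc (toℕ m))                ≡⟨ cong (code S) (ℤ.+-comm 1ℤ (+ toℕ m)) ⟩
      code S (+ toℕ m ℤ.+ 1ℤ)               ∎)) (LDS⇒arc S (proj₁ periodic) (+ toℕ m))
      where open ≡-Reasoning

    S≗S[walkOf] : S ≗ S[ walkOf ]
    S≗S[walkOf] (i , j) = begin
      S (i , j)                                         ≡⟨ lookup-block S i j ⟨
      lookup (lookup (block S q) r) i                   ≡⟨ cong (λ B → lookup (lookup B r) i) block≡ ⟨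
      S[ walkOf ] (i , j)                               ∎
      where
      open ≡-Reasoning
      q = (j ℤ.- 1ℤ) /ℕ 2
      r = fromℕ< (n%ℕd<d (j ℤ.- 1ℤ) 2)
      block≡ : proj₁ (at walkOf (residue p q)) ≡ block S q
      block≡ = begin
        proj₁ (at walkOf (residue p q))       ≡⟨ cong proj₁ (at-walkOf (residue p q)) ⟩
        block S (+ toℕ (residue p q))         ≡⟨ cong (λ n → block S (+ n)) (toℕ-residue p q) ⟩
        block S (+ (q %ℕ p))                  ≡⟨ periodic-%ℕ p (block S) block-period q ⟩
        block S q                             ∎

    distinctWindows⇒cycle : DistinctWindows p S → IsCycle walkOf
    distinctWindows⇒cycle distinct = walkOf-closed , λ {m} {n} eq → distinct m n
      (code≡⇒sameWindow S (toℕ m) (toℕ n) (trans (sym (at-walkOf m)) (trans eq (at-walkOf n))))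

-- Cycles of minimum mean

private variable
  A : Set

-- The default is the value past the end. Below it is chosen to be the vertex at which a cycle
-- closes, so that index `length xs` returns to the start.
nth : A → List A → ℕ → A
nth d []       n       = d
nth d (x ∷ xs) zero    = x
nth d (x ∷ xs) (suc n) = nth d xs n

nth-length : ∀ (d : A) xs → nth d xs (length xs) ≡ d
nth-length d []       = refl
nth-length d (x ∷ xs) = nth-length d xs

nth-∈ : ∀ (d : A) xs n → n < length xs → nth d xs n ∈ xs
nth-∈ d (x ∷ xs) zero    _        = here refl
nth-∈ d (x ∷ xs) (suc n) (s≤s n<) = there (nth-∈ d xs n n<)

nth-injective : ∀ {d : A} {xs} → Unique xs → ∀ m n → m < length xs → n < length xs → nth d xs m ≡ nth d xs n → m ≡ n
nth-injective (x∉ ∷ u) zero    zero    _        _        eq = refl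
nth-injective (x∉ ∷ u) zero    (suc n) _        (s≤s n<) eq = contradiction eq (All.lookup x∉ (nth-∈ _ _ n n<))
nth-injective (x∉ ∷ u) (suc m) zero    (s≤s m<) _        eq = contradiction (sym eq) (All.lookup x∉ (nth-∈ _ _ m m<))
nth-injective (x∉ ∷ u) (suc m) (suc n) (s≤s m<) (s≤s n<) eq = cong suc (nth-injective u m n m< n< eq)

∑-nth : ∀ (f : A → ℕ) d xs → ∑ (f ∘ nth d xs) (length xs) ≡ sum (List.map f xs)
∑-nth f d []       = refl
∑-nth f d (x ∷ xs) = trans (∑-suc (f ∘ nth d (x ∷ xs)) (length xs)) (cong (f x ℕ.+_) (∑-nth f d xs))

-- The default `y` is also the entry that follows `xs`, so it is the target of the last arc.
Linked-prefix : ∀ {R : Rel A 0ℓ} xs {y ys} → Linked R (xs List.++ y ∷ ys) → ∀ m → m < length xs → R (nth y xs m) (nth y xs (suc m))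
Linked-prefix (x ∷ [])      (r ∷ l) zero    _        = r
Linked-prefix (x ∷ [])      (r ∷ l) (suc m) (s≤s ())
Linked-prefix (x ∷ x′ ∷ xs) (r ∷ l) zero    _        = r
Linked-prefix (x ∷ x′ ∷ xs) (r ∷ l) (suc m) (s≤s m<) = Linked-prefix (x′ ∷ xs) l m m<

Linked-suffix : ∀ {R : Rel A 0ℓ} xs {ys} → Linked R (xs List.++ ys) → Linked R ys
Linked-suffix []       l = l
Linked-suffix (x ∷ xs) l = Linked-suffix xs (Linked.tail l)

Unique-split : ∀ xs {y : A} {ys} → Unique (xs List.++ y ∷ ys) → Unique (y ∷ xs) × Unique (y ∷ ys)
Unique-split []       u        = [] ∷ [] , u
Unique-split (x ∷ xs) (x∉ ∷ u) with Unique-split xs u | All.++⁻ xs x∉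
... | y∉ ∷ u₁ , u₂ | x∉xs , (x≢y ∷ _) = ((≢-sym x≢y) ∷ y∉) ∷ (x∉xs ∷ u₁) , u₂

vectors : List A → ∀ n → List (Vec A n)
vectors xs zero    = [] ∷ []
vectors xs (suc n) = cartesianProductWith _∷_ xs (vectors xs n)

∈-vectors : ∀ {xs : List A} → (∀ x → x ∈ xs) → ∀ {n} (v : Vec A n) → v ∈ vectors xs n
∈-vectors all []      = here refl
∈-vectors all (x ∷ v) = ∈-cartesianProductWith⁺ _∷_ (all x) (∈-vectors all v)

strips : ∀ k n → List (Strip k n)
strips k n = vectors (vectors (true ∷ false ∷ []) k) n

∈-strips : ∀ {k n} (X : Strip k n) → X ∈ strips k n
∈-strips = ∈-vectors (∈-vectors λ { true → here refl ; false → there (here refl) })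

codes : ∀ k → List (Code k)
codes k = cartesianProduct (strips k 2) (strips k 2)

∈-codes : ∀ {k} (B : Code k) → B ∈ codes k
∈-codes (X , Y) = ∈-cartesianProduct⁺ (∈-strips X) (∈-strips Y)

_≟ᶜ_ : ∀ {k} → DecidableEquality (Code k)
_≟ᶜ_ = ≡-dec ≟ ≟
  where ≟ = Vec.≡-dec (Vec.≡-dec Bool._≟_)

targetWeight : ∀ {k} → Code k → ℕ
targetWeight (_ , Y) = ∣ Y ∣ˢ

module _ {k : ℕ} (b : ℕ → Code k) (p : ℕ) .{{_ : NonZero p}} (closed : b p ≡ b 0) where

  private
    b-mod : ∀ m → m < p → b (suc m % p) ≡ b (suc m)
    b-mod m m<p with ℕ.m≤n⇒m<n∨m≡n m<p
    ... | inj₁ 1+m<p = cong b (m<n⇒m%n≡m 1+m<p)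
    ... | inj₂ refl  = trans (cong b (n%n≡0 (suc m))) (sym closed)

    at-next : ∀ m → at (tabulate {n = p} (b ∘ toℕ)) (next {k} m) ≡ b (suc (toℕ m))
    at-next m = trans (Vec.lookup∘tabulate _ (next {k} m)) (trans
      (cong b (Fin.toℕ-fromℕ< (m%n<n (suc (toℕ m)) p))) (b-mod (toℕ m) (Fin.toℕ<n m)))

  tabulate-closedWalk : (∀ m → m < p → Arc (b m) (b (suc m))) → IsClosedWalk (tabulate {n = p} (b ∘ toℕ))
  tabulate-closedWalk arcs m = subst₂ Arc (sym (Vec.lookup∘tabulate _ m)) (sym (at-next m)) (arcs (toℕ m) (Fin.toℕ<n m))

  tabulate-weight : weight (tabulate {n = p} (b ∘ toℕ)) ≡ ∑ (targetWeight ∘ b ∘ suc) p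
  tabulate-weight = trans (cong Vec.sum (Vec.tabulate-cong λ m → cong targetWeight (at-next m)))
                          (∑-tabulate (targetWeight ∘ b ∘ suc) p)

-- Loop erasure: a walk is read from its end, and whenever it returns to a
-- vertex of the simple path kept so far, a cycle is cut off.
module _ {k w p : ℕ} (minimum : ∀ q (D : Vec (Code k) (suc q)) → IsCycle D → w * suc q ≤ weight D * p) where

  private
    pathWeight : List (Code k) → ℕ
    pathWeight = sum ∘ List.map targetWeight

    -- The closed walk from `a` through `xs` back to `a` has no repeated vertex, so `minimum`
    -- applies to it. Its arcs are weighted by their targets: the entries of `xs`, then the second
    -- `a`.
    cycle-bound : ∀ a xs {ys} → Linked Arc (a ∷ xs List.++ a ∷ ys) → Unique (a ∷ xs) →
                  w * suc (length xs) ≤ (pathWeight xs + targetWeight a) * p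
    cycle-bound a xs linked unique = subst (λ n → w * suc (length xs) ≤ n * p) weight≡
      (minimum (length xs) C (tabulate-closedWalk b _ closed (Linked-prefix (a ∷ xs) linked) , injective))
      where
      b = nth a (a ∷ xs)
      closed : b (suc (length xs)) ≡ b 0
      closed = nth-length a (a ∷ xs)
      C = tabulate {n = suc (length xs)} (b ∘ toℕ)
      injective : Injective _≡_ _≡_ (at C)
      injective {m} {n} eq = Fin.toℕ-injective (nth-injective {d = a} unique (toℕ m) (toℕ n) (Fin.toℕ<n m) (Fin.toℕ<n n)
        (trans (sym (Vec.lookup∘tabulate (b ∘ toℕ) m)) (trans eq (Vec.lookup∘tabulate (b ∘ toℕ) n))))
      weight≡ : weight C ≡ pathWeight xs + targetWeight a
      weight≡ = trans (tabulate-weight b _ closed) (cong₂ _+_ (∑-nth targetWeight a xs) (cong targetWeight (nth-length a xs)))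

    -- `n - length ps` arcs have been cut off in cycles, and their weight is the total weight minus
    -- `pathWeight ps`. The inequality says that their mean is at least `w / p`, with subtraction
    -- and division cleared.
    ErasedPath : (ℕ → Code k) → ℕ → Set
    ErasedPath b n = ∃[ ps ] Linked Arc (b 0 ∷ ps) × Unique (b 0 ∷ ps) ×
      w * n + pathWeight ps * p ≤ ∑ (targetWeight ∘ b ∘ suc) n * p + w * length ps

    erase : ∀ n b → (∀ m → m < n → Arc (b m) (b (suc m))) → ErasedPath b n
    erase zero    b arcs = [] , [-] , [] ∷ [] , ℕ.≤-reflexive (ℕ.+-identityʳ (w * 0))
    erase (suc n) b arcs with erase n (b ∘ suc) (λ m m<n → arcs (suc m) (s≤s m<n))
    ... | ps , linked , unique , bound with ∈-dec _≟ᶜ_ (b 0) (b 1 ∷ ps)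
    ... | no b0∉ = b 1 ∷ ps , arcs 0 (s≤s z≤n) ∷ linked , All.¬Any⇒All¬ _ b0∉ ∷ unique , extended
      where
      open ℕ.≤-Reasoning
      v = targetWeight (b 1)
      s = pathWeight ps
      A′ = ∑ (λ m → targetWeight (b (suc (suc m)))) n
      left : ∀ w n v s p → w * suc n + (v + s) * p ≡ w * n + s * p + (w + v * p)
      left = ℕ.solve-∀
      right : ∀ a w l v p → a * p + w * l + (w + v * p) ≡ (v + a) * p + w * suc l
      right = ℕ.solve-∀
      extended : w * suc n + (v + s) * p ≤ ∑ (targetWeight ∘ b ∘ suc) (suc n) * p + w * suc (length ps)
      extended = begin
        w * suc n + (v + s) * p                      ≡⟨ left w n v s p ⟩
        w * n + s * p + (w + v * p)                  ≤⟨ ℕ.+-monoˡ-≤ _ bound ⟩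
        A′ * p + w * length ps + (w + v * p)         ≡⟨ right A′ w (length ps) v p ⟩
        (v + A′) * p + w * suc (length ps)           ≡⟨ cong (λ a → a * p + w * suc (length ps)) (∑-suc (targetWeight ∘ b ∘ suc) n) ⟨
        ∑ (targetWeight ∘ b ∘ suc) (suc n) * p + w * suc (length ps) ∎
    ... | yes b0∈ with ∈-∃++ b0∈
    ... | pre , post , eq = post , Linked-suffix pre linked′ , proj₂ (Unique-split pre unique′) , shortened
      where
      open ℕ.≤-Reasoning
      linked′ : Linked Arc (pre List.++ b 0 ∷ post)
      linked′ = subst (Linked Arc) eq linked
      unique′ : Unique (pre List.++ b 0 ∷ post)
      unique′ = subst Unique eq unique
      looped : Linked Arc (b 0 ∷ pre List.++ b 0 ∷ post)
      looped = subst (Linked Arc ∘ (b 0 ∷_)) eq (arcs 0 (s≤s z≤n) ∷ linked)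
      v  = targetWeight (b 1)
      s  = pathWeight ps
      s₀ = pathWeight pre + targetWeight (b 0)
      s₁ = pathWeight post
      l₀ = suc (length pre)
      l₁ = length post
      A′ = ∑ (λ m → targetWeight (b (suc (suc m)))) n
      length≡ : suc (length ps) ≡ l₀ + l₁
      length≡ = trans (cong length eq) (trans (List.length-++ pre) (ℕ.+-suc (length pre) l₁))
      weight≡ : v + s ≡ s₀ + s₁
      weight≡ = trans (cong pathWeight eq) (trans (cong sum (List.map-++ targetWeight pre (b 0 ∷ post)))
        (trans (sum-++ (List.map targetWeight pre) _) (sym (ℕ.+-assoc (pathWeight pre) _ s₁))))
      left : ∀ w n v s p → w * n + s * p + (w + v * p) ≡ w * suc n + (v + s) * p
      left = ℕ.solve-∀
      right : ∀ a w l v p → a * p + w * l + (w + v * p) ≡ (v + a) * p + w * suc l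
      right = ℕ.solve-∀
      split : ∀ x w l s p → w * l + (x + s * p) ≡ x + (w * l + s * p)
      split = ℕ.solve-∀
      join : ∀ a w l₀ l₁ → a + w * (l₀ + l₁) ≡ w * l₀ + (a + w * l₁)
      join = ℕ.solve-∀
      shortened : w * suc n + s₁ * p ≤ ∑ (targetWeight ∘ b ∘ suc) (suc n) * p + w * l₁
      -- The term `w * l₀` is added on both sides so that `cycle-bound` can trade it for the weight
      -- `s₀ * p` of the cycle being cut off.
      shortened = ℕ.+-cancelˡ-≤ (w * l₀) _ _ (begin
        w * l₀ + (w * suc n + s₁ * p)            ≡⟨ split (w * suc n) w l₀ s₁ p ⟩
        w * suc n + (w * l₀ + s₁ * p)            ≤⟨ ℕ.+-monoʳ-≤ (w * suc n) (ℕ.+-monoˡ-≤ (s₁ * p) (cycle-bound (b 0) pre looped (proj₁ (Unique-split pre unique′)))) ⟩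
        w * suc n + (s₀ * p + s₁ * p)            ≡⟨ cong (ℕ._+_ (w * suc n)) (ℕ.*-distribʳ-+ p s₀ s₁) ⟨
        w * suc n + (s₀ + s₁) * p                ≡⟨ cong (λ x → w * suc n + x * p) weight≡ ⟨
        w * suc n + (v + s) * p                  ≡⟨ left w n v s p ⟨
        w * n + s * p + (w + v * p)              ≤⟨ ℕ.+-monoˡ-≤ _ bound ⟩
        A′ * p + w * length ps + (w + v * p)     ≡⟨ right A′ w (length ps) v p ⟩
        (v + A′) * p + w * suc (length ps)       ≡⟨ cong₂ (λ a l → a * p + w * l) (sym (∑-suc (targetWeight ∘ b ∘ suc) n)) length≡ ⟩
        ∑ (targetWeight ∘ b ∘ suc) (suc n) * p + w * (l₀ + l₁)  ≡⟨ join _ w l₀ l₁ ⟩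
        w * l₀ + (∑ (targetWeight ∘ b ∘ suc) (suc n) * p + w * l₁) ∎)

  -- What survives the erasure is a simple path, no longer than the number of codes. The error is
  -- therefore a constant independent of `n` and of the walk.
  walk-bound : ∀ n b → (∀ m → m < n → Arc (b m) (b (suc m))) →
               w * n ≤ ∑ (targetWeight ∘ b ∘ suc) n * p + w * length (codes k)
  walk-bound n b arcs with erase n b arcs
  ... | ps , _ , unique , bound = begin
    w * n                                                          ≤⟨ ℕ.m≤m+n _ _ ⟩
    w * n + pathWeight ps * p                                      ≤⟨ bound ⟩
    ∑ (targetWeight ∘ b ∘ suc) n * p + w * length ps               ≤⟨ ℕ.+-monoʳ-≤ _ (ℕ.*-monoʳ-≤ w length≤) ⟩
    ∑ (targetWeight ∘ b ∘ suc) n * p + w * length (codes k)        ∎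
    where
    open ℕ.≤-Reasoning
    length≤ : length ps ≤ length (codes k)
    length≤ = ℕ.≤-trans (ℕ.n≤1+n _) (Unique-⊆⇒length≤ unique (λ {B} _ → ∈-codes B))

-- Decidability of arcs and cycles, and existence of a minimum mean cycle

module _ {k ℓ : ℕ} where

  private
    all² : ∀ {P : Pred (Fin k × Fin ℓ) 0ℓ} → (∀ v → Dec (P v)) → Dec (∀ v → P v)
    all² P? = map′ (λ f (i , c) → f i c) (λ f i c → f (i , c)) (Fin.all? λ i → Fin.all? λ c → P? (i , c))

    any² : ∀ {P : Pred (Fin k × Fin ℓ) 0ℓ} → (∀ v → Dec (P v)) → Dec (∃ P)
    any² P? = map′ (λ (i , c , x) → (i , c) , x) (λ ((i , c) , x) → i , c , x) (Fin.any? λ i → Fin.any? λ c → P? (i , c))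

    ≐? : ∀ {P Q : Pred (Fin k × Fin ℓ) 0ℓ} → (∀ v → Dec (P v)) → (∀ v → Dec (Q v)) → Dec (P ≐ Q)
    ≐? P? Q? = map′ (λ (f , g) → (λ {x} → f x) , λ {x} → g x) (λ (f , g) → (λ x → f {x}) , λ x → g {x})
      (all² (λ v → P? v →-dec Q? v) ×-dec all² (λ v → Q? v →-dec P? v))

  ~? : ∀ (u v : Fin k × ℤ) → Dec (Graph._~_ (H k) u v)
  ~? u v = map′ (Equivalence.to exact) (Equivalence.from exact) (∈-dec _≟_ v elements)
    where
    open LocallyFiniteGraph (Hᶠ k) using (_≟_; neighbors)
    open Finite (neighbors u)

  -- All quantifiers in the barcode condition range over the finitely many vertices of the bar.
  isBarcode? : ∀ (B : Strip k ℓ) → Dec (IsBarcode B)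
  isBarcode? B =
    all² (λ v → inner? v →-dec ¬? (B∋? v) →-dec any² (N∩B? v)) ×-dec
    (all² λ u → all² λ v → inner? u →-dec inner? v →-dec ¬? (B∋? u) →-dec ¬? (B∋? v) →-dec
      ¬? (≡-dec Fin._≟_ Fin._≟_ u v) →-dec ¬? (≐? (N∩B? u) (N∩B? v)))
    where
    B∋? : ∀ (v : Fin k × Fin ℓ) → Dec (proj₁ v FS.∈ lookup B (proj₂ v))
    B∋? (i , c) = i FS.∈? lookup B c
    inner? : ∀ (v : Fin k × Fin ℓ) → Dec (InnerColumn (proj₂ v))
    inner? (i , c) = (1 ℕ.<? suc (toℕ c)) ×-dec (suc (toℕ c) ℕ.<? ℓ)
    N∩B? : ∀ u v → Dec (Graph._~_ (Bar k ℓ) u v × proj₁ v FS.∈ lookup B (proj₂ v))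
    N∩B? u v = ~? (inGrid u) (inGrid v) ×-dec B∋? v

arc? : ∀ {k} (B B′ : Code k) → Dec (Arc B B′)
arc? (X , Y) (X′ , Y′) = isBarcode? (X ++ Y) ×-dec isBarcode? (X′ ++ Y′)
  ×-dec Vec.≡-dec (Vec.≡-dec Bool._≟_) Y X′ ×-dec isBarcode? (X ++ Y ++ Y′)

isCycle? : ∀ {k p} .{{_ : NonZero p}} (C : Vec (Code k) p) → Dec (IsCycle C)
isCycle? {k} C = Fin.all? (λ m → arc? (at C m) (at C (next {k} m))) ×-dec
  map′ (λ f {m} {n} → f m n) (λ f m n → f {m} {n}) (Fin.all? λ m → Fin.all? λ n → (at C m ≟ᶜ at C n) →-dec (m Fin.≟ n))

cycle-length≤ : ∀ {k p} (C : Vec (Code k) p) → Injective _≡_ _≡_ (lookup C) → p ≤ length (codes k)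
cycle-length≤ {k} {p} C inj = subst (_≤ length (codes k)) (List.length-tabulate (lookup C))
  (Unique-⊆⇒length≤ (Unique.tabulate⁺ inj) (λ {B} _ → ∈-codes B))

module _ (k : ℕ) where

  private
    -- The set of all vertices is vacuously locating-dominating. It yields a loop, which shows that
    -- `G_k` has a cycle and is the starting value of `argmin`.
    full : VertexSet (H k)
    full _ = true

    full-periodicLDS : IsPeriodicLDS {k} 2 full
    full-periodicLDS = ((λ v _ v∉ → contradiction _ v∉) , (λ u v _ _ u∉ → contradiction _ u∉)) , s≤s z≤n , λ _ _ → refl

    Candidate : Set
    Candidate = ∃[ n ] Vec (Code k) (suc n)

    loop : Candidate
    loop = 0 , walkOf {p = 1} full full-periodicLDS

    loop-isCycle : IsCycle (proj₂ loop)
    loop-isCycle = walkOf-closed {p = 1} full full-periodicLDS , λ { {zero} {zero} _ → refl }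

    -- A candidate with first component `n` has length `suc n`, so `n < length (codes k)` covers
    -- every length that `cycle-length≤` allows.
    candidates : List Candidate
    candidates = concatMap (λ n → List.map (n ,_) (vectors (codes k) (suc n))) (upTo (length (codes k)))

    candidate-mean : Candidate → ℚ
    candidate-mean (_ , C) = mean C

    Cyclic? : ∀ (C : Candidate) → Dec (IsCycle (proj₂ C))
    Cyclic? (_ , C) = isCycle? C

    best : Candidate
    best = argmin candidate-mean loop (filter Cyclic? candidates)

  minimumMeanCycle : ∃[ n ] ∃[ C ] IsMinimumMeanCycle {k} {suc n} C
  minimumMeanCycle = proj₁ best , proj₂ best , argmin-all candidate-mean {P = λ C → IsCycle (proj₂ C)} loop-isCycle (All.all-filter Cyclic? candidates) , λ where
    (suc q) D D-cycle → All.lookup (f[argmin]≤f[xs] {f = candidate-mean} loop (filter Cyclic? candidates)) (∈-filter⁺ Cyclic?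
      (∈-concatMap⁺ (λ n → List.map (n ,_) (vectors (codes k) (suc n)))
        (lose (∈-upTo⁺ (cycle-length≤ D (proj₂ D-cycle))) (∈-map⁺ (q ,_) (∈-vectors ∈-codes D)))) D-cycle)

-- Balls and rectangles

module _ (G : LocallyFiniteGraph) where

  open LocallyFiniteGraph G

  walk? : ∀ v u n → Dec (Walk v u n)
  walk? v u zero    = map′ (λ { refl → [] }) (λ { [] → refl }) (v ≟ u)
  walk? v u (suc n) = map′ extend split (any? (λ w → walk? v w n) elements)
    where
    open Finite (neighbors u)
    extend : _ → Walk v u (suc n)
    extend w∈ with find w∈
    ... | w , w∈N , walk = walk ∷ʳ ~-sym (Equivalence.to exact w∈N)
    split : Walk v u (suc n) → _
    split (walk ∷ʳ e) = lose (Equivalence.from exact (~-sym e)) walk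

  -- Descent on the length: as `walk?` is decidable, either some shorter walk exists and the search
  -- goes on from it, or the given walk is shortest.
  walk⇒Dist : ∀ {v u} n → Walk v u n → ∃[ d ] d ≤ n × Dist v u d
  walk⇒Dist {v} {u} = <-rec _ λ n shorter walk → shorten n shorter walk (ℕ.anyUpTo? (walk? v u) n)
    where
    shorten : ∀ n → (∀ {m} → m < n → Walk v u m → ∃[ d ] d ≤ m × Dist v u d) → Walk v u n →
              Dec (∃[ m ] m < n × Walk v u m) → ∃[ d ] d ≤ n × Dist v u d
    shorten n shorter walk (no minimal)             = n , ℕ.≤-refl , walk , λ m walk′ → ℕ.≮⇒≥ λ m<n → minimal (m , m<n , walk′)
    shorten n shorter walk (yes (m , m<n , walk′)) with shorter m<n walk′
    ... | d , d≤m , dist = d , ℕ.≤-trans d≤m (ℕ.<⇒≤ m<n) , dist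

  walk⇒N[] : ∀ {v u r n} → Walk v u n → n ≤ r → v ≢ u → N[ r ] v u
  walk⇒N[] {n = n} walk n≤r v≢u with walk⇒Dist n walk
  ... | zero  , _   , []   , _   = contradiction refl v≢u
  ... | suc d , d≤n , dist = suc d , dist , z<s , ℕ.≤-trans d≤n n≤r

  -- Lengths are bounded rather than exact, because moving to an adjacent row takes one step or
  -- three, depending on the column.
  Within : V → V → ℕ → Set
  Within u v n = ∃[ m ] m ≤ n × Walk u v m

  within-∷ʳ : ∀ {u v w n} → Within u v n → v ~ w → Within u w (suc n)
  within-∷ʳ (m , m≤n , walk) e = suc m , s≤s m≤n , walk ∷ʳ e

  within-≤ : ∀ {u v m n} → m ≤ n → Within u v m → Within u v n
  within-≤ m≤n (l , l≤m , walk) = l , ℕ.≤-trans l≤m m≤n , walk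

even-or-suc-even : ∀ n → + 2 ℤ.∣ n ⊎ + 2 ℤ.∣ n ℤ.+ 1ℤ
even-or-suc-even n with n %ℕ 2 | n%ℕd<d n 2 | a≡a%ℕn+[a/ℕn]*n n 2
... | 0 | _ | eq = inj₁ (ℤˢ.∣⇒∣ᵤ (ℤˢ.divides (n /ℕ 2) (trans eq (ℤ.+-identityˡ _))))
... | 1 | _ | eq = inj₂ (ℤˢ.∣⇒∣ᵤ (ℤˢ.divides (n /ℕ 2 ℤ.+ 1ℤ) (trans (cong (ℤ._+ 1ℤ) eq) (identity (n /ℕ 2)))))
  where
  identity : ∀ q → 1ℤ ℤ.+ q ℤ.* + 2 ℤ.+ 1ℤ ≡ (q ℤ.+ 1ℤ) ℤ.* + 2
  identity = ℤ.solve-∀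
... | suc (suc _) | s≤s (s≤s ()) | _

-- Changing rows costs at most κ k extra steps: a rung is missing in every
-- second column, and a detour around it has length 3.
κ : ℕ → ℕ
κ k = 6 * k

module _ {k : ℕ} where

  private
    G = Hᶠ (suc k)
  open LocallyFiniteGraph G using (_~_; ~-sym; Walk; []; _∷ʳ_; N[_]; N[_]-finite; densityRatio)

  row-step : ∀ (i : Fin k) {j} → + 2 ℤ.∣ row (inject₁ i) ℤ.+ j → (inject₁ i , j) ~ (suc i , j)
  row-step i even = fwd (inj₂ (trans (cong (λ n → + suc n) (sym (trans (ℕ.+-comm (toℕ (inject₁ i)) 1) (cong suc (Fin.toℕ-inject₁ i))))) refl , refl , even))

  right-step : ∀ (i : Fin (suc k)) j → (i , j) ~ (i , j ℤ.+ 1ℤ)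
  right-step i j = fwd (inj₁ (refl , refl))

  within-vertical : ∀ {u n} i {j} →
    (Within G u (inject₁ i , j) n → Within G u (suc i , j) (3 + n)) ×
    (Within G u (suc i , j) n → Within G u (inject₁ i , j) (3 + n))
  within-vertical {n = n} i {j} with even-or-suc-even (row (inject₁ i) ℤ.+ j)
  ... | inj₁ even = (λ w → within-≤ G (ℕ.m≤n+m (suc n) 2) (within-∷ʳ G w (row-step i even)))
                  , (λ w → within-≤ G (ℕ.m≤n+m (suc n) 2) (within-∷ʳ G w (~-sym (row-step i even))))
  ... | inj₂ odd  = (λ w → within-∷ʳ G (within-∷ʳ G (within-∷ʳ G w (right-step _ j)) (row-step i even)) (~-sym (right-step _ j)))
                  , (λ w → within-∷ʳ G (within-∷ʳ G (within-∷ʳ G w (right-step _ j)) (~-sym (row-step i even))) (~-sym (right-step _ j)))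
    where
    even : + 2 ℤ.∣ row (inject₁ i) ℤ.+ (j ℤ.+ 1ℤ)
    even = subst (+ 2 ℤ.∣_) (ℤ.+-assoc (row (inject₁ i)) j 1ℤ) odd

  -- The route goes down to the first row and up again, at no more than 3 steps per row each way.
  -- With `k + 1` rows this costs at most `3k + 3k`, whence the factor 6 in `κ`.
  within-column : ∀ {u n} i i′ {j} → Within G u (i , j) n → Within G u (i′ , j) (3 * toℕ i′ + (3 * toℕ i + n))
  within-column i i′ w = up i′ (down i w)
    where
    size : ∀ (i : Fin k) n → 3 + (3 * toℕ (inject₁ i) + n) ≡ 3 * suc (toℕ i) + n
    size i n = trans (cong (λ m → 3 + (3 * m + n)) (Fin.toℕ-inject₁ i)) (identity (toℕ i) n)
      where
      identity : ∀ m n → 3 + (3 * m + n) ≡ 3 * suc m + n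
      identity = ℕ.solve-∀
    up : ∀ {u n} i {j} → Within G u (zero , j) n → Within G u (i , j) (3 * toℕ i + n)
    up {u} {n} i {j} = <-weakInduction (λ i → Within G u (zero , j) n → Within G u (i , j) (3 * toℕ i + n)) id
      (λ i ih w → subst (Within G u (suc i , j)) (size i n) (proj₁ (within-vertical i) (ih w))) i
    down : ∀ {u n} i {j} → Within G u (i , j) n → Within G u (zero , j) (3 * toℕ i + n)
    -- The motive quantifies over `n` because the row change is made first and the induction
    -- hypothesis is used with the enlarged bound.
    down {u} {n} i {j} = <-weakInduction (λ i → ∀ {n} → Within G u (i , j) n → Within G u (zero , j) (3 * toℕ i + n)) id
      (λ i ih {n} w → subst (Within G u (zero , j)) (shuffle i n) (ih (proj₂ (within-vertical i) w))) i
      where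
      shuffle : ∀ (i : Fin k) n → 3 * toℕ (inject₁ i) + (3 + n) ≡ 3 * suc (toℕ i) + n
      shuffle i n = trans (swap (3 * toℕ (inject₁ i)) n) (size i n)
        where
        swap : ∀ a n → a + (3 + n) ≡ 3 + (a + n)
        swap = ℕ.solve-∀

  within-row : ∀ {u n i j} d → Within G u (i , j) n → Within G u (i , j ℤ.+ d) (ℤ.∣ d ∣ + n)
  within-row {u} {n} {i} {j} (+ zero)    w = subst (λ j → Within G u (i , j) n) (sym (ℤ.+-identityʳ j)) w
  within-row {u} {n} {i} {j} (+ suc d)   w = subst (λ j → Within G u (i , j) (suc d + n)) (identity j (+ d))
    (within-∷ʳ G (within-row (+ d) w) (right-step i (j ℤ.+ + d)))
    where
    identity : ∀ j d → j ℤ.+ d ℤ.+ 1ℤ ≡ j ℤ.+ (1ℤ ℤ.+ d)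
    identity = ℤ.solve-∀
  within-row {u} {n} {i} {j} -[1+ zero ] w = within-∷ʳ G w (bwd (inj₁ (refl , identity j)))
    where
    identity : ∀ j → j ≡ j ℤ.+ -1ℤ ℤ.+ 1ℤ
    identity = ℤ.solve-∀
  within-row {u} {n} {i} {j} -[1+ suc d ] w = within-∷ʳ G (within-row -[1+ d ] w) (bwd (inj₁ (refl , identity j -[1+ d ])))
    where
    identity : ∀ j d → j ℤ.+ d ≡ j ℤ.+ (-1ℤ ℤ.+ d) ℤ.+ 1ℤ
    identity = ℤ.solve-∀

  within-κ : ∀ i j i′ d → Within G (i , j) (i′ , j ℤ.+ d) (ℤ.∣ d ∣ + κ k)
  within-κ i j i′ d = within-row d (within-≤ G (begin
    3 * toℕ i′ + (3 * toℕ i + 0)  ≤⟨ ℕ.+-mono-≤ (ℕ.*-monoʳ-≤ 3 (Fin.toℕ≤pred[n] i′)) (ℕ.+-monoˡ-≤ 0 (ℕ.*-monoʳ-≤ 3 (Fin.toℕ≤pred[n] i))) ⟩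
    3 * k + (3 * k + 0)           ≡⟨ identity k ⟩
    6 * k                         ∎) (within-column i i′ (0 , z≤n , [])))
    where
    open ℕ.≤-Reasoning
    identity : ∀ k → 3 * k + (3 * k + 0) ≡ 6 * k
    identity = ℕ.solve-∀

  walk-column≤ : ∀ {u v n} → Walk u v n → ℤ.∣ proj₂ v ℤ.- proj₂ u ∣ ≤ n
  walk-column≤ {_ , j} []   = ℕ.≤-reflexive (cong ℤ.∣_∣ (ℤ.+-inverseʳ j))
  walk-column≤ {_ , j} {_ , j″} (_∷ʳ_ {_ , j′} {n = n} walk e) = begin
    ℤ.∣ j″ ℤ.- j ∣                            ≡⟨ cong ℤ.∣_∣ (identity j j′ j″) ⟩
    ℤ.∣ (j″ ℤ.- j′) ℤ.+ (j′ ℤ.- j) ∣           ≤⟨ ℤ.∣i+j∣≤∣i∣+∣j∣ (j″ ℤ.- j′) (j′ ℤ.- j) ⟩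
    ℤ.∣ j″ ℤ.- j′ ∣ + ℤ.∣ j′ ℤ.- j ∣           ≤⟨ ℕ.+-mono-≤ (edge (~-columns e)) (walk-column≤ walk) ⟩
    suc n                                     ∎
    where
    open ℕ.≤-Reasoning
    identity : ∀ j j′ j″ → j″ ℤ.- j ≡ (j″ ℤ.- j′) ℤ.+ (j′ ℤ.- j)
    identity = ℤ.solve-∀
    forward : ∀ j → j ℤ.+ 1ℤ ℤ.- j ≡ 1ℤ
    forward = ℤ.solve-∀
    backward : ∀ j → j ℤ.- (j ℤ.+ 1ℤ) ≡ -1ℤ
    backward = ℤ.solve-∀
    edge : (j″ ≡ j′) ⊎ (j″ ≡ j′ ℤ.+ 1ℤ) ⊎ (j′ ≡ j″ ℤ.+ 1ℤ) → ℤ.∣ j″ ℤ.- j′ ∣ ≤ 1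
    edge (inj₁ refl)        = subst (_≤ 1) (sym (cong ℤ.∣_∣ (ℤ.+-inverseʳ j′))) z≤n
    edge (inj₂ (inj₁ refl)) = ℕ.≤-reflexive (cong ℤ.∣_∣ (forward j′))
    edge (inj₂ (inj₂ refl)) = ℕ.≤-reflexive (cong ℤ.∣_∣ (backward j″))

columnCount : ∀ {k} → VertexSet (H k) → ℤ → ℕ
columnCount S j = FS.∣ column S j ∣

count : ∀ {k} → VertexSet (H k) → ℤ → ℕ → ℕ
count S a = ∑ λ m → columnCount S (a ℤ.+ + m)

rect : ∀ k → ℤ → ℕ → List (Fin k × ℤ)
rect k a zero    = []
rect k a (suc n) = rect k a n List.++ List.tabulate λ i → i , a ℤ.+ + n

length-rect : ∀ k a n → length (rect k a n) ≡ n * k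
length-rect k a zero    = refl
length-rect k a (suc n) = trans (List.length-++ (rect k a n))
  (trans (cong₂ _+_ (length-rect k a n) (List.length-tabulate {n = k} _)) (ℕ.+-comm (n * k) k))

length-filter-tabulate : ∀ {A : Set} (S : A → Bool) {k} (f : Fin k → A) →
  length (filterᵇ S (List.tabulate f)) ≡ FS.∣ Vec.tabulate (S ∘ f) ∣
length-filter-tabulate S {zero}  f = refl
length-filter-tabulate S {suc k} f with S (f zero)
... | true  = cong suc (length-filter-tabulate S (f ∘ suc))
... | false = length-filter-tabulate S (f ∘ suc)

count-rect : ∀ {k} (S : VertexSet (H k)) a n → length (filterᵇ S (rect k a n)) ≡ count S a n
count-rect S a zero    = refl
count-rect {k} S a (suc n) = begin
  length (filterᵇ S (rect k a n List.++ col))                    ≡⟨ cong length (List.filter-++ (T? ∘ S) (rect k a n) col) ⟩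
  length (filterᵇ S (rect k a n) List.++ filterᵇ S col)          ≡⟨ List.length-++ (filterᵇ S (rect k a n)) ⟩
  length (filterᵇ S (rect k a n)) + length (filterᵇ S col)       ≡⟨ cong₂ _+_ (count-rect S a n) (length-filter-tabulate S {k} (λ i → i , a ℤ.+ + n)) ⟩
  count S a n + columnCount S (a ℤ.+ + n)                        ∎
  where
  open ≡-Reasoning
  col = List.tabulate {n = k} λ i → i , a ℤ.+ + n

∈-rect⁺ : ∀ {k a} n {i : Fin k} {m} → m < n → (i , a ℤ.+ + m) ∈ rect k a n
∈-rect⁺ (suc n) (s≤s m≤n) with ℕ.m≤n⇒m<n∨m≡n m≤n
... | inj₁ m<n  = ∈-++⁺ˡ (∈-rect⁺ n m<n)
... | inj₂ refl = ∈-++⁺ʳ (rect _ _ n) (∈-tabulate⁺ _)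

∈-rect⁻ : ∀ {k a} n {x} → x ∈ rect k a n → ∃[ m ] m < n × proj₂ x ≡ a ℤ.+ + m
∈-rect⁻ {k} {a} (suc n) x∈ with ∈-++⁻ (rect k a n) x∈
... | inj₁ x∈′ with ∈-rect⁻ n x∈′
... | m , m<n , eq = m , ℕ.m<n⇒m<1+n m<n , eq
∈-rect⁻ {k} {a} (suc n) x∈ | inj₂ x∈′ with ∈-tabulate⁻ x∈′
... | i , refl = n , ℕ.n<1+n n , refl

rect-unique : ∀ k a n → Unique (rect k a n)
rect-unique k a zero    = []
rect-unique k a (suc n) = Unique.++⁺ (rect-unique k a n) (Unique.tabulate⁺ (cong proj₁)) disjoint
  where
  disjoint : ∀ {x} → ¬ (x ∈ rect k a n × x ∈ List.tabulate (λ i → i , a ℤ.+ + n))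
  disjoint (x∈ , x∈′) with ∈-rect⁻ n x∈ | ∈-tabulate⁻ x∈′
  ... | m , m<n , eq | i , refl = ℕ.<⇒≢ m<n (sym (ℤ.+-injective (∙-cancelˡ a _ _ eq)))

∣m-s∣≤s : ∀ s m → m < suc (2 * s) → ℤ.∣ + m ℤ.- + s ∣ ≤ s
∣m-s∣≤s s m (s≤s m≤2s) = subst (λ z → ℤ.∣ z ∣ ≤ s) (sym (ℤ.m-n≡m⊖n m s)) (bound (ℕ.≤-total m s))
  where
  bound : m ≤ s ⊎ s ≤ m → ℤ.∣ m ℤ.⊖ s ∣ ≤ s
  bound (inj₁ m≤s) = subst (_≤ s) (sym (ℤ.∣⊖∣-≤ m≤s)) (ℕ.m∸n≤m s m)
  bound (inj₂ s≤m) = subst (_≤ s) (sym (cong ℤ.∣_∣ (ℤ.⊖-≥ s≤m)))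
    (ℕ.m≤n+o⇒m∸n≤o m s (ℕ.≤-trans m≤2s (ℕ.≤-reflexive (cong (ℕ._+_ s) (ℕ.+-identityʳ s)))))

∣d∣≤r⇒d+r : ∀ d r → ℤ.∣ d ∣ ≤ r → ∃[ m ] m < suc (2 * r) × d ℤ.+ + r ≡ + m
∣d∣≤r⇒d+r (+ d)    r d≤r = d + r , s≤s (ℕ.+-mono-≤ d≤r (ℕ.m≤m+n r 0)) , refl
∣d∣≤r⇒d+r -[1+ d ] r d<r = r ∸ suc d , s≤s (ℕ.≤-trans (ℕ.m∸n≤m r (suc d)) (ℕ.m≤m+n r (r + 0))) , ℤ.⊖-≥ d<r

module _ {k : ℕ} (S : VertexSet (H (suc k))) (v : Fin (suc k) × ℤ) where

  open LocallyFiniteGraph (Hᶠ (suc k)) using (N[_]; N[_]-finite; _≟_)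

  ballSize : ℕ → ℕ
  ballSize r = length (Finite.elements (N[ r ]-finite v))

  ballCount : ℕ → ℕ
  ballCount r = length (filterᵇ S (Finite.elements (N[ r ]-finite v)))

  private
    ball = λ r → Finite.elements (N[ r ]-finite v)
    outer = λ r → rect (suc k) (proj₂ v ℤ.- + r) (suc (2 * r))

    ball⊆outer : ∀ r {x} → x ∈ ball r → x ∈ outer r
    ball⊆outer r {i , j} x∈ with Equivalence.to (Finite.exact (N[ r ]-finite v)) x∈
    ... | d , (walk , _) , _ , d≤r with ∣d∣≤r⇒d+r (j ℤ.- proj₂ v) r (ℕ.≤-trans (walk-column≤ walk) d≤r)
    ... | m , m≤2r , eq = subst (λ j → (i , j) ∈ outer r)
      (trans (cong (ℤ._+_ (proj₂ v ℤ.- + r)) (sym eq)) (identity (proj₂ v) (+ r) j)) (∈-rect⁺ (suc (2 * r)) m≤2r)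
      where
      identity : ∀ a r j → a ℤ.- r ℤ.+ (j ℤ.- a ℤ.+ r) ≡ j
      identity = ℤ.solve-∀

    -- The centre must be added by hand, since `N[ r ] v` leaves out `v`. This is the origin of the
    -- `suc` in `ballSize≥` and `ballCount≥`.
    inner⊆ball : ∀ s {x} → x ∈ outer s → x ∈ v ∷ ball (s + κ k)
    inner⊆ball s {i , j} x∈ with v ≟ (i , j) | ∈-rect⁻ {a = proj₂ v ℤ.- + s} (suc (2 * s)) x∈
    ... | yes refl | _ = here refl
    ... | no v≢x | m , m<2s , refl with within-κ (proj₁ v) (proj₂ v) i (+ m ℤ.- + s)
    ... | n , n≤ , walk = there (Equivalence.from (Finite.exact (N[ s + κ k ]-finite v)) (walk⇒N[] (Hᶠ (suc k))
      (subst (λ j → LocallyFiniteGraph.Walk (Hᶠ (suc k)) v (i , j) n) (identity (proj₂ v) (+ m) (+ s)) walk)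
      (ℕ.≤-trans n≤ (ℕ.+-monoˡ-≤ (κ k) (∣m-s∣≤s s m m<2s))) v≢x))
      where
      identity : ∀ a m s → a ℤ.+ (m ℤ.- s) ≡ a ℤ.- s ℤ.+ m
      identity = ℤ.solve-∀

    ball-unique : ∀ r → Unique (ball r)
    ball-unique r = Finite.unique (N[ r ]-finite v)

    filter-mono : ∀ {xs ys : List (Fin (suc k) × ℤ)} → (∀ {x} → x ∈ xs → x ∈ ys) → ∀ {x} → x ∈ filterᵇ S xs → x ∈ filterᵇ S ys
    filter-mono xs⊆ys x∈ with ∈-filter⁻ (T? ∘ S) x∈
    ... | x∈xs , Sx = ∈-filter⁺ (T? ∘ S) (xs⊆ys x∈xs) Sx

  ballSize≤ : ∀ r → ballSize r ≤ suc (2 * r) * suc k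
  ballSize≤ r = ℕ.≤-trans (Unique-⊆⇒length≤ (ball-unique r) (ball⊆outer r)) (ℕ.≤-reflexive (length-rect (suc k) _ (suc (2 * r))))

  ballSize≥ : ∀ s → suc (2 * s) * suc k ≤ suc (ballSize (s + κ k))
  ballSize≥ s = ℕ.≤-trans (ℕ.≤-reflexive (sym (length-rect (suc k) _ (suc (2 * s)))))
    (Unique-⊆⇒length≤ (rect-unique (suc k) _ (suc (2 * s))) (inner⊆ball s))

  ballCount≤ : ∀ r → ballCount r ≤ count S (proj₂ v ℤ.- + r) (suc (2 * r))
  ballCount≤ r = ℕ.≤-trans (Unique-⊆⇒length≤ (Unique.filter⁺ (T? ∘ S) (ball-unique r)) (filter-mono (ball⊆outer r)))
    (ℕ.≤-reflexive (count-rect S _ (suc (2 * r))))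

  ballCount≥ : ∀ s → count S (proj₂ v ℤ.- + s) (suc (2 * s)) ≤ suc (ballCount (s + κ k))
  ballCount≥ s = begin
    count S (proj₂ v ℤ.- + s) (suc (2 * s))           ≡⟨ count-rect S _ (suc (2 * s)) ⟨
    length (filterᵇ S (outer s))                      ≤⟨ Unique-⊆⇒length≤ (Unique.filter⁺ (T? ∘ S) (rect-unique (suc k) _ (suc (2 * s)))) (filter-mono (inner⊆ball s)) ⟩
    length (filterᵇ S (v ∷ ball (s + κ k)))         ≤⟨ filter-∷ (S v) refl ⟩
    suc (ballCount (s + κ k))                       ∎
    where
    open ℕ.≤-Reasoning
    filter-∷ : ∀ b → S v ≡ b → length (filterᵇ S (v ∷ ball (s + κ k))) ≤ suc (ballCount (s + κ k))
    filter-∷ b eq with S v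
    ... | true  = ℕ.≤-refl
    ... | false = ℕ.n≤1+n _

  -- Serves twice: it makes the denominator of the density ratio nonzero, and it makes a constant
  -- error negligible against the size of the ball.
  ballSize-large : ∀ s → s ≤ ballSize (s + κ k)
  ballSize-large s = ℕ.≤-trans (ℕ.m≤m+n s (s + 0)) (ℕ.≤-pred (ℕ.≤-trans (ℕ.m≤m*n (suc (2 * s)) (suc k)) (ballSize≥ s)))

-- Weights of walks and numbers of selected vertices

module _ {k : ℕ} (S : VertexSet (H k)) where

  count-+ : ∀ a m n → count S a (m + n) ≡ count S a m + count S (a ℤ.+ + m) n
  count-+ a m n = trans (∑-+ (λ i → columnCount S (a ℤ.+ + i)) m n)
    (cong (ℕ._+_ (count S a m)) (∑-cong n λ i _ → cong (columnCount S) (sym (ℤ.+-assoc a (+ m) (+ i)))))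

  count-within : ∀ a r {m n} → r + m ≤ n → count S (a ℤ.+ + r) m ≤ count S a n
  count-within a r {m} {n} r+m≤n = begin
    count S (a ℤ.+ + r) m                         ≤⟨ ℕ.m≤n+m _ (count S a r) ⟩
    count S a r + count S (a ℤ.+ + r) m           ≡⟨ count-+ a r m ⟨
    count S a (r + m)                             ≤⟨ ℕ.m≤m+n _ _ ⟩
    count S a (r + m) + count S (a ℤ.+ + (r + m)) (n ∸ (r + m))  ≡⟨ count-+ a (r + m) (n ∸ (r + m)) ⟨
    count S a (r + m + (n ∸ (r + m)))             ≡⟨ cong (count S a) (ℕ.m+[n∸m]≡n r+m≤n) ⟩
    count S a n                                   ∎
    where open ℕ.≤-Reasoning

  count-mono : ∀ a {m n} → m ≤ n → count S a m ≤ count S a n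
  count-mono a {m} {n} m≤n = subst (λ b → count S b m ≤ count S a n) (ℤ.+-identityʳ a) (count-within a 0 m≤n)

  count-blocks : ∀ t n → ∑ (λ m → ∣ block S (t ℤ.+ + m) ∣ˢ) n ≡ count S (+ 2 ℤ.* t ℤ.+ 1ℤ) (n * 2)
  count-blocks t zero    = refl
  count-blocks t (suc n) = trans (cong₂ _+_ (count-blocks t n) last) (sym (ℕ.+-assoc (count S a (n * 2)) (columnCount S (a ℤ.+ + (n * 2))) (columnCount S (a ℤ.+ + suc (n * 2)))))
    where
    a = + 2 ℤ.* t ℤ.+ 1ℤ
    first : ∀ t n → + 2 ℤ.* (t ℤ.+ n) ℤ.+ 1ℤ ≡ + 2 ℤ.* t ℤ.+ 1ℤ ℤ.+ n ℤ.* + 2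
    first = ℤ.solve-∀
    second : ∀ t n → + 2 ℤ.* (t ℤ.+ n) ℤ.+ + 2 ≡ + 2 ℤ.* t ℤ.+ 1ℤ ℤ.+ (1ℤ ℤ.+ n ℤ.* + 2)
    second = ℤ.solve-∀
    last : ∣ block S (t ℤ.+ + n) ∣ˢ ≡ columnCount S (a ℤ.+ + (n * 2)) + columnCount S (a ℤ.+ + suc (n * 2))
    last = cong₂ _+_
      (cong (columnCount S) (trans (first t (+ n)) (cong (ℤ._+_ a) (sym (ℤ.pos-* n 2)))))
      (trans (ℕ.+-identityʳ _) (cong (columnCount S) (trans (second t (+ n)) (cong (λ z → a ℤ.+ (1ℤ ℤ.+ z)) (sym (ℤ.pos-* n 2))))))

  module _ {p : ℕ} .{{_ : NonZero p}} (period : ∀ i j → S (i , j) ≡ S (i , j ℤ.+ + p)) where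

    private
      columnCount-period : ∀ j → columnCount S (j ℤ.+ + p) ≡ columnCount S j
      columnCount-period j = cong FS.∣_∣ (Vec.tabulate-cong λ i → sym (period i j))

      -- Sliding the window by one drops column `a` and gains column `a + p`, which has the same
      -- count by periodicity.
      count-suc : ∀ a → count S (a ℤ.+ 1ℤ) p ≡ count S a p
      count-suc a = ℕ.+-cancelˡ-≡ (columnCount S (a ℤ.+ 0ℤ)) _ _ (begin
        columnCount S (a ℤ.+ 0ℤ) + count S (a ℤ.+ 1ℤ) p       ≡⟨ cong (ℕ._+_ (columnCount S (a ℤ.+ 0ℤ))) (∑-cong p λ m _ → cong (columnCount S) (ℤ.+-assoc a 1ℤ (+ m))) ⟩
        columnCount S (a ℤ.+ 0ℤ) + ∑ (λ m → columnCount S (a ℤ.+ + suc m)) p  ≡⟨ ∑-suc (λ m → columnCount S (a ℤ.+ + m)) p ⟨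
        count S a p + columnCount S (a ℤ.+ + p)              ≡⟨ cong (ℕ._+_ (count S a p)) (trans (columnCount-period a) (cong (columnCount S) (sym (ℤ.+-identityʳ a)))) ⟩
        count S a p + columnCount S (a ℤ.+ 0ℤ)               ≡⟨ ℕ.+-comm (count S a p) _ ⟩
        columnCount S (a ℤ.+ 0ℤ) + count S a p               ∎)
        where open ≡-Reasoning

    count-period : ∀ a b → count S a p ≡ count S b p
    count-period a b = trans (ℤ-constant (λ a → count S a p) count-suc a) (sym (ℤ-constant (λ a → count S a p) count-suc b))

    module _ (a : ℤ) where

      private
        w = count S a p

        count-periods : ∀ b q → count S b (q * p) ≡ q * w
        count-periods b zero    = refl
        count-periods b (suc q) = trans (count-+ b p (q * p)) (cong₂ _+_ (count-period b a) (count-periods (b ℤ.+ + p) q))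

        module _ (n : ℕ) where
          q = n ℕ./ p
          qp≤n : q * p ≤ n
          qp≤n = ℕ.m/n*n≤m n p
          n≤[1+q]p : n ≤ suc q * p
          n≤[1+q]p = begin
            n                      ≡⟨ ℕ.m≡m%n+[m/n]*n n p ⟩
            n ℕ.% p + q * p        ≤⟨ ℕ.+-monoˡ-≤ (q * p) (ℕ.<⇒≤ (ℕ.m%n<n n p)) ⟩
            suc q * p              ∎
            where open ℕ.≤-Reasoning

      -- With `q = n / p`, the width `n` lies between `q * p` and `suc q * p`, and whole periods are
      -- counted exactly; the error is at most one period.
      count-periodic-lower : ∀ b n → w * n ≤ p * count S b n + p * w
      count-periodic-lower b n = begin
        w * n                              ≤⟨ ℕ.*-monoʳ-≤ w (n≤[1+q]p n) ⟩
        w * (suc (q n) * p)                ≡⟨ identity w (q n) p ⟩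
        p * (q n * w) + p * w              ≡⟨ cong (λ c → p * c + p * w) (count-periods b (q n)) ⟨
        p * count S b (q n * p) + p * w    ≤⟨ ℕ.+-monoˡ-≤ (p * w) (ℕ.*-monoʳ-≤ p (count-mono b (qp≤n n))) ⟩
        p * count S b n + p * w            ∎
        where
        open ℕ.≤-Reasoning
        identity : ∀ w q p → w * (suc q * p) ≡ p * (q * w) + p * w
        identity = ℕ.solve-∀

      count-periodic-upper : ∀ b n → p * count S b n ≤ w * n + p * w
      count-periodic-upper b n = begin
        p * count S b n                    ≤⟨ ℕ.*-monoʳ-≤ p (count-mono b (n≤[1+q]p n)) ⟩
        p * count S b (suc (q n) * p)      ≡⟨ cong (ℕ._*_ p) (count-periods b (suc (q n))) ⟩
        p * (suc (q n) * w)                ≡⟨ identity w (q n) p ⟩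
        w * (q n * p) + p * w              ≤⟨ ℕ.+-monoˡ-≤ (p * w) (ℕ.*-monoʳ-≤ w (qp≤n n)) ⟩
        w * n + p * w                      ∎
        where
        open ℕ.≤-Reasoning
        identity : ∀ w q p → p * (suc q * w) ≡ w * (q * p) + p * w
        identity = ℕ.solve-∀

-- The arc leaving entry 0 counts the right half of entry 1, which is block 2 of `S[ C ]`. That
-- block begins at column 5, whence the start `+ 5`.
count-weight : ∀ {k p} .{{_ : NonZero p}} (C : Vec (Code k) p) → IsClosedWalk C → count S[ C ] (+ 5) (2 * p) ≡ weight C
count-weight {k} {p} C walk = begin
  count S[ C ] (+ 5) (2 * p)                                  ≡⟨ cong (count S[ C ] (+ 5)) (ℕ.*-comm 2 p) ⟩
  count S[ C ] (+ 5) (p * 2)                                  ≡⟨ count-blocks S[ C ] (+ 2) p ⟨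
  ∑ (λ m → ∣ block S[ C ] (+ 2 ℤ.+ + m) ∣ˢ) p                 ≡⟨ ∑-tabulate (λ m → ∣ block S[ C ] (+ 2 ℤ.+ + m) ∣ˢ) p ⟨
  Vec.sum (Vec.tabulate {n = p} λ m → ∣ block S[ C ] (+ 2 ℤ.+ + toℕ m) ∣ˢ)  ≡⟨ cong Vec.sum (Vec.tabulate-cong λ m → cong ∣_∣ˢ (step m)) ⟩
  weight C                                                    ∎
  where
  open ≡-Reasoning
  swap : ∀ m → + 2 ℤ.+ m ≡ m ℤ.+ 1ℤ ℤ.+ 1ℤ
  swap = ℤ.solve-∀
  step : ∀ m → block S[ C ] (+ 2 ℤ.+ + toℕ m) ≡ proj₂ (at C (next {k} m))
  step m = begin
    block S[ C ] (+ 2 ℤ.+ + toℕ m)                 ≡⟨ cong (block S[ C ]) (swap (+ toℕ m)) ⟩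
    block S[ C ] (+ toℕ m ℤ.+ 1ℤ ℤ.+ 1ℤ)           ≡⟨ cong proj₂ (closedWalk-code C walk (+ toℕ m ℤ.+ 1ℤ)) ⟨
    proj₂ (at C (residue p (+ toℕ m ℤ.+ 1ℤ)))      ≡⟨ cong (proj₂ ∘ at C) (residue-suc p (+ toℕ m)) ⟩
    proj₂ (at C (next {k} (residue p (+ toℕ m))))  ≡⟨ cong (λ m → proj₂ (at C (next {k} m))) (residue-toℕ p m) ⟩
    proj₂ (at C (next {k} m))                      ∎

module _ {k w p : ℕ} (minimum : ∀ q (D : Vec (Code k) (suc q)) → IsCycle D → w * suc q ≤ weight D * p)
         {S : VertexSet (H k)} (lds : IsLDS (H k) S) where

  private
    excess = w * length (codes k)

    -- The walk of codes starts at block `t`, but its first arc already counts block `t + 2`, so the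
    -- counted columns begin at `2 * (2 + t) + 1`.
    even-lower : ∀ t n → w * n ≤ count S (+ 2 ℤ.* (+ 2 ℤ.+ t) ℤ.+ 1ℤ) (n * 2) * p + excess
    even-lower t n = subst (λ c → w * n ≤ c * p + excess) (trans (∑-cong n λ m _ → cong (λ t → ∣ block S t ∣ˢ) (swap t (+ m))) (count-blocks S (+ 2 ℤ.+ t) n))
      (walk-bound {w = w} {p} minimum n (λ m → code S (t ℤ.+ + m)) λ m _ → subst (Arc (code S (t ℤ.+ + m)) ∘ code S)
        (trans (ℤ.+-assoc t (+ m) 1ℤ) (cong (λ n → t ℤ.+ + n) (ℕ.+-comm m 1))) (LDS⇒arc S lds (t ℤ.+ + m)))
      where
      swap : ∀ t m → t ℤ.+ (1ℤ ℤ.+ m) ℤ.+ 1ℤ ≡ + 2 ℤ.+ t ℤ.+ m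
      swap = ℤ.solve-∀

    odd-start : ∀ a → ∃[ t ] ∃[ r ] r ≤ 1 × + 2 ℤ.* (+ 2 ℤ.+ t) ℤ.+ 1ℤ ≡ a ℤ.+ + r
    odd-start a with a %ℕ 2 | n%ℕd<d a 2 | a≡a%ℕn+[a/ℕn]*n a 2
    ... | 0 | _ | eq = a /ℕ 2 ℤ.- + 2 , 1 , ℕ.≤-refl , trans (identity (a /ℕ 2)) (cong (ℤ._+ 1ℤ) (sym eq))
      where
      identity : ∀ q → + 2 ℤ.* (+ 2 ℤ.+ (q ℤ.- + 2)) ℤ.+ 1ℤ ≡ 0ℤ ℤ.+ q ℤ.* + 2 ℤ.+ 1ℤ
      identity = ℤ.solve-∀
    ... | 1 | _ | eq = a /ℕ 2 ℤ.- + 2 , 0 , z≤n , trans (identity (a /ℕ 2)) (cong (ℤ._+ 0ℤ) (sym eq))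
      where
      identity : ∀ q → + 2 ℤ.* (+ 2 ℤ.+ (q ℤ.- + 2)) ℤ.+ 1ℤ ≡ 1ℤ ℤ.+ q ℤ.* + 2 ℤ.+ 0ℤ
      identity = ℤ.solve-∀
    ... | suc (suc _) | s≤s (s≤s ()) | _

  -- Blocks begin at odd columns, and one of `a` and `a + 1` is odd. At most two columns of the
  -- window fall outside the blocks, which accounts for `2 * w`; passing from blocks to columns
  -- doubles `excess`.
  count-lower : ∀ a n → w * n ≤ (2 * p) * count S a n + (2 * excess + 2 * w)
  count-lower a zero    = ℕ.≤-trans (ℕ.≤-reflexive (ℕ.*-zeroʳ w)) z≤n
  count-lower a (suc n) with odd-start a
  ... | t , r , r≤1 , eq = begin
    w * suc n                                                          ≤⟨ ℕ.*-monoʳ-≤ w (s≤s n≤1+N*2) ⟩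
    w * suc (suc (N * 2))                                              ≡⟨ left w N ⟩
    2 * (w * N) + 2 * w                                                ≤⟨ ℕ.+-monoˡ-≤ (2 * w) (ℕ.*-monoʳ-≤ 2 (even-lower t N)) ⟩
    2 * (count S (+ 2 ℤ.* (+ 2 ℤ.+ t) ℤ.+ 1ℤ) (N * 2) * p + excess) + 2 * w  ≡⟨ cong (λ b → 2 * (count S b (N * 2) * p + excess) + 2 * w) eq ⟩
    2 * (count S (a ℤ.+ + r) (N * 2) * p + excess) + 2 * w             ≤⟨ ℕ.+-monoˡ-≤ (2 * w) (ℕ.*-monoʳ-≤ 2 (ℕ.+-monoˡ-≤ excess (ℕ.*-monoˡ-≤ p (count-within S a r r+N*2≤)))) ⟩
    2 * (count S a (suc n) * p + excess) + 2 * w                       ≡⟨ right (count S a (suc n)) p excess w ⟩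
    2 * p * count S a (suc n) + (2 * excess + 2 * w)                   ∎
    where
    open ℕ.≤-Reasoning
    -- After `r ≤ 1` columns are skipped, at least `n` of the `suc n` columns are left, enough for
    -- `N` whole blocks.
    N = n ℕ./ 2
    n≤1+N*2 : n ≤ suc (N * 2)
    n≤1+N*2 = ℕ.≤-trans (ℕ.≤-reflexive (ℕ.m≡m%n+[m/n]*n n 2)) (ℕ.+-monoˡ-≤ (N * 2) (ℕ.≤-pred (ℕ.m%n<n n 2)))
    r+N*2≤ : r + N * 2 ≤ suc n
    r+N*2≤ = ℕ.+-mono-≤ r≤1 (ℕ.m/n*n≤m n 2)
    left : ∀ w N → w * suc (suc (N * 2)) ≡ 2 * (w * N) + 2 * w
    left = ℕ.solve-∀
    right : ∀ c p e w → 2 * (c * p + e) + 2 * w ≡ 2 * p * c + (2 * e + 2 * w)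
    right = ℕ.solve-∀

-- From rectangles to balls

module _ {k : ℕ} (S : VertexSet (H (suc k))) (P Q E : ℕ) where

  private
    K = suc k

  -- The size of the ball is bounded by the outer rectangle and its count by the inner one. The two
  -- differ in `2 * κ k` columns, hence the last error term; `K * Q` pays for the missing centre.
  ball-lower : (∀ a n → P * n ≤ Q * count S a n + E) → ∀ v s →
    P * ballSize S v (s + κ k) ≤ Q * K * ballCount S v (s + κ k) + (K * (Q + E) + 2 * κ k * P * K)
  ball-lower lower v s = begin
    P * ballSize S v (s + d)                             ≤⟨ ℕ.*-monoʳ-≤ P (ballSize≤ S v (s + d)) ⟩
    P * (suc (2 * (s + d)) * K)                          ≡⟨ split P s d K ⟩
    K * (P * suc (2 * s)) + 2 * d * P * K                ≤⟨ ℕ.+-monoˡ-≤ (2 * d * P * K) (ℕ.*-monoʳ-≤ K (ℕ.≤-trans (lower (proj₂ v ℤ.- + s) (suc (2 * s))) (ℕ.+-monoˡ-≤ E (ℕ.*-monoʳ-≤ Q (ballCount≥ S v s))))) ⟩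
    K * (Q * suc (ballCount S v (s + d)) + E) + 2 * d * P * K  ≡⟨ join K Q (ballCount S v (s + d)) E (2 * d * P * K) ⟩
    Q * K * ballCount S v (s + d) + (K * (Q + E) + 2 * d * P * K) ∎
    where
    open ℕ.≤-Reasoning
    d = κ k
    split : ∀ P s d K → P * (suc (2 * (s + d)) * K) ≡ K * (P * suc (2 * s)) + 2 * d * P * K
    split = ℕ.solve-∀
    join : ∀ K Q c E x → K * (Q * suc c + E) + x ≡ Q * K * c + (K * (Q + E) + x)
    join = ℕ.solve-∀

  -- Now the count is bounded by the outer rectangle and the size by the inner one; the missing
  -- centre costs `P`.
  ball-upper : (∀ a n → Q * count S a n ≤ P * n + E) → ∀ v s →
    Q * K * ballCount S v (s + κ k) ≤ P * ballSize S v (s + κ k) + (K * E + P + 2 * κ k * P * K)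
  ball-upper upper v s = begin
    Q * K * ballCount S v (s + d)                        ≤⟨ ℕ.*-monoʳ-≤ (Q * K) (ballCount≤ S v (s + d)) ⟩
    Q * K * count S (proj₂ v ℤ.- + (s + d)) (suc (2 * (s + d)))  ≡⟨ swap Q K _ ⟩
    K * (Q * count S (proj₂ v ℤ.- + (s + d)) (suc (2 * (s + d))))  ≤⟨ ℕ.*-monoʳ-≤ K (upper (proj₂ v ℤ.- + (s + d)) (suc (2 * (s + d)))) ⟩
    K * (P * suc (2 * (s + d)) + E)                      ≡⟨ split P s d K E ⟩
    P * (suc (2 * s) * K) + (K * E + 2 * d * P * K)      ≤⟨ ℕ.+-monoˡ-≤ (K * E + 2 * d * P * K) (ℕ.*-monoʳ-≤ P (ballSize≥ S v s)) ⟩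
    P * suc (ballSize S v (s + d)) + (K * E + 2 * d * P * K)  ≡⟨ join P (ballSize S v (s + d)) (K * E) (2 * d * P * K) ⟩
    P * ballSize S v (s + d) + (K * E + P + 2 * d * P * K)  ∎
    where
    open ℕ.≤-Reasoning
    d = κ k
    swap : ∀ Q K c → Q * K * c ≡ K * (Q * c)
    swap = ℕ.solve-∀
    split : ∀ P s d K E → K * (P * suc (2 * (s + d)) + E) ≡ P * (suc (2 * s) * K) + (K * E + 2 * d * P * K)
    split = ℕ.solve-∀
    join : ∀ P b x y → P * suc b + (x + y) ≡ P * b + (x + P + y)
    join = ℕ.solve-∀

-- Densities

-- Both `fromℕ` and division of an integer reduce to a fraction in lowest terms. Identities are
-- checked on unreduced fractions, where they are equations between integers, and transported back.
fromℚᵘ-* : ∀ x y → ℚ.fromℚᵘ x ℚ.* ℚ.fromℚᵘ y ≡ ℚ.fromℚᵘ (x ℚᵘ.* y)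
fromℚᵘ-* x y = ℚ.toℚᵘ-injective (ℚᵘ.≃-trans (ℚ.toℚᵘ-homo-* (ℚ.fromℚᵘ x) (ℚ.fromℚᵘ y))
  (ℚᵘ.≃-trans (ℚᵘ.*-cong (ℚ.toℚᵘ-fromℚᵘ x) (ℚ.toℚᵘ-fromℚᵘ y)) (ℚᵘ.≃-sym (ℚ.toℚᵘ-fromℚᵘ (x ℚᵘ.* y)))))

fromℚᵘ-+ : ∀ x y → ℚ.fromℚᵘ x ℚ.+ ℚ.fromℚᵘ y ≡ ℚ.fromℚᵘ (x ℚᵘ.+ y)
fromℚᵘ-+ x y = ℚ.toℚᵘ-injective (ℚᵘ.≃-trans (ℚ.toℚᵘ-homo-+ (ℚ.fromℚᵘ x) (ℚ.fromℚᵘ y))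
  (ℚᵘ.≃-trans (ℚᵘ.+-cong (ℚ.toℚᵘ-fromℚᵘ x) (ℚ.toℚᵘ-fromℚᵘ y)) (ℚᵘ.≃-sym (ℚ.toℚᵘ-fromℚᵘ (x ℚᵘ.+ y)))))

fromℚᵘ-mono-≤ : ∀ {x y} → x ℚᵘ.≤ y → ℚ.fromℚᵘ x ℚ.≤ ℚ.fromℚᵘ y
fromℚᵘ-mono-≤ {x} {y} x≤y = ℚ.toℚᵘ-cancel-≤
  (ℚᵘ.≤-respˡ-≃ (ℚᵘ.≃-sym (ℚ.toℚᵘ-fromℚᵘ x)) (ℚᵘ.≤-respʳ-≃ (ℚᵘ.≃-sym (ℚ.toℚᵘ-fromℚᵘ y)) x≤y))

fromℕ-* : ∀ m n → fromℕ m ℚ.* fromℕ n ≡ fromℕ (m * n)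
fromℕ-* m n = trans (fromℚᵘ-* (ℚᵘ.mkℚᵘ (+ m) 0) (ℚᵘ.mkℚᵘ (+ n) 0))
  (ℚ.fromℚᵘ-cong {ℚᵘ.mkℚᵘ (+ m) 0 ℚᵘ.* ℚᵘ.mkℚᵘ (+ n) 0} {ℚᵘ.mkℚᵘ (+ (m * n)) 0} (ℚᵘ.*≡* (cong (ℤ._* 1ℤ) (sym (ℤ.pos-* m n)))))

fromℕ-+ : ∀ m n → fromℕ m ℚ.+ fromℕ n ≡ fromℕ (m + n)
fromℕ-+ m n = trans (fromℚᵘ-+ (ℚᵘ.mkℚᵘ (+ m) 0) (ℚᵘ.mkℚᵘ (+ n) 0))
  (ℚ.fromℚᵘ-cong {ℚᵘ.mkℚᵘ (+ m) 0 ℚᵘ.+ ℚᵘ.mkℚᵘ (+ n) 0} {ℚᵘ.mkℚᵘ (+ (m + n)) 0} (ℚᵘ.*≡* (cong (ℤ._* 1ℤ) (cong₂ ℤ._+_ (ℤ.*-identityʳ (+ m)) (ℤ.*-identityʳ (+ n))))))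

fromℕ-mono-≤ : ∀ {m n} → m ≤ n → fromℕ m ℚ.≤ fromℕ n
fromℕ-mono-≤ {m} {n} m≤n = fromℚᵘ-mono-≤ {ℚᵘ.mkℚᵘ (+ m) 0} {ℚᵘ.mkℚᵘ (+ n) 0} (ℚᵘ.*≤* (ℤ.*-monoʳ-≤-nonNeg 1ℤ (ℤ.+≤+ m≤n)))

fromℕ-cancel-≤ : ∀ {m n} → fromℕ m ℚ.≤ fromℕ n → m ≤ n
fromℕ-cancel-≤ {m} {n} le with ℚᵘ.≤-respˡ-≃ (ℚ.toℚᵘ-fromℚᵘ (ℚᵘ.mkℚᵘ (+ m) 0))
  (ℚᵘ.≤-respʳ-≃ (ℚ.toℚᵘ-fromℚᵘ (ℚᵘ.mkℚᵘ (+ n) 0)) (ℚ.toℚᵘ-mono-≤ le))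
... | ℚᵘ.*≤* le′ = ℤ.drop‿+≤+ (subst₂ ℤ._≤_ (ℤ.*-identityʳ (+ m)) (ℤ.*-identityʳ (+ n)) le′)

/-*-fromℕ : ∀ i n .{{_ : NonZero n}} → (i ℚ./ n) ℚ.* fromℕ n ≡ i ℚ./ 1
/-*-fromℕ i (suc n) = trans (fromℚᵘ-* (ℚᵘ.mkℚᵘ i n) (ℚᵘ.mkℚᵘ (+ suc n) 0))
  (ℚ.fromℚᵘ-cong {ℚᵘ.mkℚᵘ i n ℚᵘ.* ℚᵘ.mkℚᵘ (+ suc n) 0} {ℚᵘ.mkℚᵘ i 0} (ℚᵘ.*≡* (trans (ℤ.*-identityʳ (i ℤ.* + suc n)) (cong (λ m → i ℤ.* + m) (sym (ℕ.*-identityʳ (suc n)))))))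

÷ℕ-*-fromℕ : ∀ x n .{{_ : NonZero n}} → (x ÷ℕ n) ℚ.* fromℕ n ≡ x
÷ℕ-*-fromℕ x (suc n) = trans (ℚ.*-assoc x _ _) (trans (cong (x ℚ.*_) (/-*-fromℕ 1ℤ (suc n))) (ℚ.*-identityʳ x))

cross-≤ : ∀ {x y : ℚ} a b p q → x ℚ.* fromℕ p ≡ fromℕ a → y ℚ.* fromℕ q ≡ fromℕ b → x ℚ.≤ y → a * q ≤ b * p
cross-≤ {x} {y} a b p q xp≡a yq≡b x≤y = fromℕ-cancel-≤ (begin
  fromℕ (a * q)                        ≡⟨ fromℕ-* a q ⟨
  fromℕ a ℚ.* fromℕ q                  ≡⟨ cong (ℚ._* fromℕ q) xp≡a ⟨
  x ℚ.* fromℕ p ℚ.* fromℕ q            ≡⟨ ℚ.*-assoc x (fromℕ p) (fromℕ q) ⟩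
  x ℚ.* (fromℕ p ℚ.* fromℕ q)          ≡⟨ cong (ℚ._*_ x) (fromℕ-* p q) ⟩
  x ℚ.* fromℕ (p * q)                  ≤⟨ ℚ.*-monoʳ-≤-nonNeg (fromℕ (p * q)) {{ℚ.normalize-nonNeg (p * q) 1}} x≤y ⟩
  y ℚ.* fromℕ (p * q)                  ≡⟨ cong (λ n → y ℚ.* fromℕ n) (ℕ.*-comm p q) ⟩
  y ℚ.* fromℕ (q * p)                  ≡⟨ cong (ℚ._*_ y) (fromℕ-* q p) ⟨
  y ℚ.* (fromℕ q ℚ.* fromℕ p)          ≡⟨ ℚ.*-assoc y (fromℕ q) (fromℕ p) ⟨
  y ℚ.* fromℕ q ℚ.* fromℕ p            ≡⟨ cong (ℚ._* fromℕ p) yq≡b ⟩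
  fromℕ b ℚ.* fromℕ p                  ≡⟨ fromℕ-* b p ⟩
  fromℕ (b * p)                        ∎)
  where open ℚ.≤-Reasoning

mean-* : ∀ {k p} .{{_ : NonZero p}} (C : Vec (Code k) p) → mean C ℚ.* fromℕ p ≡ fromℕ (weight C)
mean-* {p = p} C = /-*-fromℕ (+ weight C) p

mean-≤ : ∀ {k p q} .{{_ : NonZero p}} .{{_ : NonZero q}} (C : Vec (Code k) p) (D : Vec (Code k) q) →
         mean C ℚ.≤ mean D → weight C * q ≤ weight D * p
mean-≤ {p = p} {q} C D = cross-≤ {mean C} {mean D} (weight C) (weight D) p q (mean-* C) (mean-* D)

-- If `ε` is `suc a / suc d`, then `N = n * suc d` gives `N * ε = n * suc a`, which is at least `n`.
archimedean : ∀ n ε → 0ℚ ℚ.< ε → ∃[ N ] fromℕ n ℚ.≤ fromℕ N ℚ.* ε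
archimedean n (mkℚ (+ zero)  d cop) 0<ε with ℚ.<⇒≢ 0<ε (ℚ.toℚᵘ-injective (ℚᵘ.*≡* refl))
... | ()
archimedean n (mkℚ -[1+ a ] d cop) (ℚ.*<* ())
archimedean n ε@(mkℚ (+ suc a) d cop) 0<ε = n * suc d , (begin
  fromℕ n                                 ≤⟨ fromℕ-mono-≤ (ℕ.m≤m*n n (suc a)) ⟩
  fromℕ (n * suc a)                       ≡⟨ fromℕ-* n (suc a) ⟨
  fromℕ n ℚ.* fromℕ (suc a)               ≡⟨ cong (fromℕ n ℚ.*_) (trans (ℚ.*-comm (fromℕ (suc d)) ε) (trans (cong (ℚ._* fromℕ (suc d)) (sym (ℚ.↥p/↧p≡p ε))) (/-*-fromℕ (+ suc a) (suc d)))) ⟨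
  fromℕ n ℚ.* (fromℕ (suc d) ℚ.* ε)       ≡⟨ ℚ.*-assoc (fromℕ n) (fromℕ (suc d)) ε ⟨
  fromℕ n ℚ.* fromℕ (suc d) ℚ.* ε         ≡⟨ cong (ℚ._* ε) (fromℕ-* n (suc d)) ⟩
  fromℕ (n * suc d) ℚ.* ε                 ∎)
  where open ℚ.≤-Reasoning

-- If `y < x`, a rational `m` strictly between them gives the slack `m - y`, for which the
-- hypothesis says `x ≤ m`.
≤+-limit : ∀ {x y} → (∀ ε → 0ℚ ℚ.< ε → x ℚ.≤ y ℚ.+ ε) → x ℚ.≤ y
≤+-limit {x} {y} close = ℚ.≮⇒≥ λ y<x → let m , y<m , m<x = ℚ.<-dense y<x in
  ℚ.<-irrefl refl (ℚ.<-≤-trans m<x (subst (x ℚ.≤_) (cancel y m) (close (m ℚ.- y) (subst (ℚ._< m ℚ.- y) (ℚ.+-inverseʳ y) (ℚ.+-monoˡ-< (ℚ.- y) y<m)))))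
  where
  cancel : ∀ y m → y ℚ.+ (m ℚ.- y) ≡ m
  cancel = solve 2 (λ y m → y :+ (m :- y) := m) refl
    where open +-*-Solver

≤⇒≤+ : ∀ {x y ε} → 0ℚ ℚ.< ε → x ℚ.≤ y → x ℚ.≤ y ℚ.+ ε
≤⇒≤+ {x} {y} {ε} 0<ε x≤y = subst (ℚ._≤ y ℚ.+ ε) (ℚ.+-identityʳ x) (ℚ.+-mono-≤ x≤y (ℚ.<⇒≤ 0<ε))

-≤⇒≤+ : ∀ {x y} ε → x ℚ.- ε ℚ.≤ y → x ℚ.≤ y ℚ.+ ε
-≤⇒≤+ {x} {y} ε x-ε≤y = subst (ℚ._≤ y ℚ.+ ε) (cancel x ε) (ℚ.+-monoˡ-≤ ε x-ε≤y)
  where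
  cancel : ∀ x ε → x ℚ.- ε ℚ.+ ε ≡ x
  cancel = solve 2 (λ x ε → x :- ε :+ ε := x) refl
    where open +-*-Solver

≤+⇒-≤ : ∀ {x y} ε → x ℚ.≤ y ℚ.+ ε → x ℚ.- ε ℚ.≤ y
≤+⇒-≤ {x} {y} ε x≤y+ε = subst (x ℚ.- ε ℚ.≤_) (cancel y ε) (ℚ.+-monoˡ-≤ (ℚ.- ε) x≤y+ε)
  where
  cancel : ∀ y ε → y ℚ.+ ε ℚ.- ε ≡ y
  cancel = solve 2 (λ y ε → y :+ ε :- ε := y) refl
    where open +-*-Solver

private
  -- After multiplication by the common denominator `s`, the error `e` is at most `N * ε` and so at
  -- most `s * ε`; then `s` cancels.
  scaled-≤ : ∀ {a b ε s N e m n : ℚ} .{{_ : ℚ.Positive s}} → m ≡ a ℚ.* s → n ≡ b ℚ.* s →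
             m ℚ.≤ n ℚ.+ e → e ℚ.≤ N ℚ.* ε → N ℚ.≤ s → 0ℚ ℚ.< ε → a ℚ.≤ b ℚ.+ ε
  scaled-≤ {a} {b} {ε} {s} {N} {e} refl refl m≤n+e e≤Nε N≤s 0<ε = ℚ.*-cancelʳ-≤-pos s (begin
    a ℚ.* s                    ≤⟨ m≤n+e ⟩
    b ℚ.* s ℚ.+ e              ≤⟨ ℚ.+-monoʳ-≤ (b ℚ.* s) e≤Nε ⟩
    b ℚ.* s ℚ.+ N ℚ.* ε        ≤⟨ ℚ.+-monoʳ-≤ (b ℚ.* s) (ℚ.*-monoʳ-≤-nonNeg ε {{ℚ.pos⇒nonNeg ε {{ℚ.positive 0<ε}}}} N≤s) ⟩
    b ℚ.* s ℚ.+ s ℚ.* ε        ≡⟨ cong (ℚ._+_ (b ℚ.* s)) (ℚ.*-comm s ε) ⟩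
    b ℚ.* s ℚ.+ ε ℚ.* s        ≡⟨ ℚ.*-distribʳ-+ s b ε ⟨
    (b ℚ.+ ε) ℚ.* s            ∎)
    where open ℚ.≤-Reasoning

  regroup : ∀ d x L → d ℚ.* (x ℚ.* L) ≡ x ℚ.* (L ℚ.* d)
  regroup d x L = trans (ℚ.*-comm d (x ℚ.* L)) (ℚ.*-assoc x L d)

  regroup′ : ∀ c d L → c ℚ.* d ℚ.* L ≡ c ℚ.* (L ℚ.* d)
  regroup′ c d L = trans (ℚ.*-assoc c d L) (cong (ℚ._*_ c) (ℚ.*-comm d L))

-- With c = P/D, the natural number inequalities say that cnt/len differs
-- from c by at most E/(D len).
module _ {c : ℚ} {P D : ℕ} .{{_ : NonZero D}} (cD≡P : c ℚ.* fromℕ D ≡ fromℕ P)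
         {E N : ℕ} {ε : ℚ} (E≤Nε : fromℕ E ℚ.≤ fromℕ N ℚ.* ε) (0<ε : 0ℚ ℚ.< ε)
         (cnt len : ℕ) .{{_ : NonZero len}} (N≤len : N ≤ len) where

  private
    x = fromℕ cnt ÷ℕ len
    s = fromℕ (len * D)

    instance
      s-positive : ℚ.Positive s
      s-positive = ℚ.normalize-pos (len * D) 1 {{_}} {{ℕ.m*n≢0 len D}}

    x-scaled : fromℕ (D * cnt) ≡ x ℚ.* s
    x-scaled = trans (sym (fromℕ-* D cnt)) (trans (cong (ℚ._*_ (fromℕ D)) (sym (÷ℕ-*-fromℕ (fromℕ cnt) len)))
      (trans (regroup (fromℕ D) x (fromℕ len)) (cong (ℚ._*_ x) (fromℕ-* len D))))

    c-scaled : fromℕ (P * len) ≡ c ℚ.* s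
    c-scaled = trans (sym (fromℕ-* P len)) (trans (cong (ℚ._* fromℕ len) (sym cD≡P))
      (trans (regroup′ c (fromℕ D) (fromℕ len)) (cong (ℚ._*_ c) (fromℕ-* len D))))

    N≤s : fromℕ N ℚ.≤ s
    N≤s = fromℕ-mono-≤ (ℕ.≤-trans N≤len (ℕ.m≤m*n len D))

    +E : ∀ {m n} → m ≤ n + E → fromℕ m ℚ.≤ fromℕ n ℚ.+ fromℕ E
    +E {m} {n} m≤n+E = subst (ℚ._≤_ (fromℕ m)) (sym (fromℕ-+ n E)) (fromℕ-mono-≤ m≤n+E)

  ÷ℕ-upper : D * cnt ≤ P * len + E → x ℚ.≤ c ℚ.+ ε
  ÷ℕ-upper le = scaled-≤ {x} {c} {s = s} x-scaled c-scaled (+E le) E≤Nε N≤s 0<ε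

  ÷ℕ-lower : P * len ≤ D * cnt + E → c ℚ.≤ x ℚ.+ ε
  ÷ℕ-lower le = scaled-≤ {c} {x} {s = s} c-scaled x-scaled (+E le) E≤Nε N≤s 0<ε

-- Infima of limits superior

≤ᶜ-trans : ∀ {x y z} → x ≤ᶜ y → y ≤ᶜ z → x ≤ᶜ z
≤ᶜ-trans (b , a) (b′ , a′) = (λ q → b′ q ∘ b q) , (λ q → a q ∘ a′ q)

module _ {I : Set} (a : I → ℕ → ℚ) {c : ℚ} where

  -- The threshold `N` is uniform in the index, so it still applies to whichever index the infimum
  -- hands over.
  inf-limsup-≥ : (∀ ε → 0ℚ ℚ.< ε → ∃[ N ] ∀ i r → N ≤ r → c ℚ.≤ a i r ℚ.+ ε) → fromℚ c ≤ᶜ inf (limsup ∘ a)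
  inf-limsup-≥ above = below-≥ , above-≥
    where
    below-≥ : ∀ q → q ℚ.≤ c → Below (inf (limsup ∘ a)) q
    below-≥ q q≤c i ε 0<ε N with above ε 0<ε
    ... | M , bound = N ℕ.⊔ M , ℕ.m≤m⊔n N M , ≤+⇒-≤ ε (ℚ.≤-trans q≤c (bound i (N ℕ.⊔ M) (ℕ.m≤n⊔m N M)))
    above-≥ : ∀ q → Above (inf (limsup ∘ a)) q → c ℚ.≤ q
    -- The three slacks belong to the infimum, to the limsup and to the hypothesis `above`, and are
    -- removed one at a time.
    above-≥ q q-above = ≤+-limit λ ε₁ 0<ε₁ → ≤+-limit λ ε₂ 0<ε₂ → ≤+-limit λ ε₃ 0<ε₃ → lemma ε₁ 0<ε₁ ε₂ 0<ε₂ ε₃ 0<ε₃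
      where
      lemma : ∀ ε₁ → 0ℚ ℚ.< ε₁ → ∀ ε₂ → 0ℚ ℚ.< ε₂ → ∀ ε₃ → 0ℚ ℚ.< ε₃ → c ℚ.≤ q ℚ.+ ε₁ ℚ.+ ε₂ ℚ.+ ε₃
      lemma ε₁ 0<ε₁ ε₂ 0<ε₂ ε₃ 0<ε₃ with q-above ε₁ 0<ε₁ | above ε₃ 0<ε₃
      ... | i , limsup-above | M , bound with limsup-above ε₂ 0<ε₂
      ... | N , bound′ = ℚ.≤-trans (bound i (N ℕ.⊔ M) (ℕ.m≤n⊔m N M)) (ℚ.+-monoˡ-≤ ε₃ (bound′ (N ℕ.⊔ M) (ℕ.m≤m⊔n N M)))

  -- A single index caps the infimum, and the same index is the witness for every slack.
  inf-limsup-≤ : I → (∀ ε → 0ℚ ℚ.< ε → ∃[ N ] ∀ i r → N ≤ r → a i r ℚ.≤ c ℚ.+ ε) → inf (limsup ∘ a) ≤ᶜ fromℚ c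
  inf-limsup-≤ i below = below-≤ , above-≤
    where
    below-≤ : ∀ q → Below (inf (limsup ∘ a)) q → q ℚ.≤ c
    below-≤ q q-below = ≤+-limit λ ε₁ 0<ε₁ → ≤+-limit λ ε₂ 0<ε₂ → lemma ε₁ 0<ε₁ ε₂ 0<ε₂
      where
      lemma : ∀ ε₁ → 0ℚ ℚ.< ε₁ → ∀ ε₂ → 0ℚ ℚ.< ε₂ → q ℚ.≤ c ℚ.+ ε₁ ℚ.+ ε₂
      lemma ε₁ 0<ε₁ ε₂ 0<ε₂ with below ε₁ 0<ε₁
      ... | M , bound with q-below i ε₂ 0<ε₂ M
      ... | r , M≤r , q-ε≤ = -≤⇒≤+ ε₂ (ℚ.≤-trans q-ε≤ (bound i r M≤r))
    above-≤ : ∀ q → c ℚ.≤ q → Above (inf (limsup ∘ a)) q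
    above-≤ q c≤q ε₁ 0<ε₁ = i , λ ε₂ 0<ε₂ → let M , bound = below ε₂ 0<ε₂ in
      M , λ r M≤r → ℚ.≤-trans (bound i r M≤r) (ℚ.+-monoˡ-≤ ε₂ (≤⇒≤+ 0<ε₁ c≤q))

inf-attained : ∀ {I : Set} (x : I → Cut) {c} i → x i ≤ᶜ fromℚ c → (∀ j → fromℚ c ≤ᶜ x j) → inf x ≈ᶜ fromℚ c
inf-attained x {c} i (below , above) lower =
    ((λ q q-below → below q (q-below i)) , (λ q c≤q ε 0<ε → i , above (q ℚ.+ ε) (≤⇒≤+ 0<ε c≤q)))
  , ((λ q q≤c j → proj₁ (lower j) q q≤c) , (λ q q-above → ≤+-limit λ ε 0<ε → let j , j-above = q-above ε 0<ε in proj₂ (lower j) (q ℚ.+ ε) j-above))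

module _ {k : ℕ} (S : VertexSet (H (suc k))) where

  open LocallyFiniteGraph (Hᶠ (suc k)) using (densityRatio)

  module _ {c : ℚ} {P Q : ℕ} .{{_ : NonZero Q}} (cQK≡P : c ℚ.* fromℕ (Q * suc k) ≡ fromℕ P) {E : ℕ} where

    private
      instance
        QK≢0 : NonZero (Q * suc k)
        QK≢0 = ℕ.m*n≢0 Q (suc k)

      -- The ball estimates are stated at radii `s + κ k`; every radius from `N + κ k` on has this
      -- form with `N ≤ s`.
      from-κ : ∀ (R : ℕ → Set) N → (∀ s → N ≤ s → R (s + κ k)) → ∀ r → N + κ k ≤ r → R r
      from-κ R N f r N+κ≤r = subst R (ℕ.m∸n+n≡m (ℕ.m+n≤o⇒n≤o N N+κ≤r)) (f (r ∸ κ k) (ℕ.m+n≤o⇒m≤o∸n N N+κ≤r))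

    density-≥ : (∀ a n → P * n ≤ Q * count S a n + E) → fromℚ c ≤ᶜ density S
    density-≥ lower = inf-limsup-≥ (densityRatio S) λ ε 0<ε → let N , E′≤Nε = archimedean (suc k * (Q + E) + 2 * κ k * P * suc k) ε 0<ε in
      -- With `suc N` in place of `N` the ball is nonempty even for `N = 0`, so the ratio is a
      -- genuine quotient and not the convention at 0.
      suc N + κ k , λ v → from-κ (λ r → c ℚ.≤ densityRatio S v r ℚ.+ ε) (suc N) λ s N<s →
        let N<len = ℕ.≤-trans N<s (ballSize-large S v s) in
        ÷ℕ-lower {c} {P} {Q * suc k} cQK≡P E′≤Nε 0<ε (ballCount S v (s + κ k)) (ballSize S v (s + κ k)) {{ℕ.>-nonZero (ℕ.≤-trans (s≤s z≤n) N<len)}}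
          (ℕ.<⇒≤ N<len) (ball-lower S P Q E lower v s)

    density-≤ : (∀ a n → Q * count S a n ≤ P * n + E) → density S ≤ᶜ fromℚ c
    density-≤ upper = inf-limsup-≤ (densityRatio S) (zero , 0ℤ) λ ε 0<ε → let N , E′≤Nε = archimedean (suc k * E + P + 2 * κ k * P * suc k) ε 0<ε in
      suc N + κ k , λ v → from-κ (λ r → densityRatio S v r ℚ.≤ c ℚ.+ ε) (suc N) λ s N<s →
        let N<len = ℕ.≤-trans N<s (ballSize-large S v s) in
        ÷ℕ-upper {c} {P} {Q * suc k} cQK≡P E′≤Nε 0<ε (ballCount S v (s + κ k)) (ballSize S v (s + κ k)) {{ℕ.>-nonZero (ℕ.≤-trans (s≤s z≤n) N<len)}}
          (ℕ.<⇒≤ N<len) (ball-upper S P Q E upper v s)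

-- Densities of closed walks, and optimality of minimum mean cycles

mean-scaled : ∀ {c m : ℚ} K p w → c ℚ.* fromℕ (2 * K) ≡ m → m ℚ.* fromℕ p ≡ fromℕ w → c ℚ.* fromℕ (2 * p * K) ≡ fromℕ w
mean-scaled {c} {m} K p w c≡ m≡ = begin
  c ℚ.* fromℕ (2 * p * K)                       ≡⟨ cong (λ n → c ℚ.* fromℕ n) (identity p K) ⟩
  c ℚ.* fromℕ (2 * K * p)                       ≡⟨ cong (ℚ._*_ c) (fromℕ-* (2 * K) p) ⟨
  c ℚ.* (fromℕ (2 * K) ℚ.* fromℕ p)             ≡⟨ ℚ.*-assoc c (fromℕ (2 * K)) (fromℕ p) ⟨
  c ℚ.* fromℕ (2 * K) ℚ.* fromℕ p               ≡⟨ cong (ℚ._* fromℕ p) c≡ ⟩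
  m ℚ.* fromℕ p                                 ≡⟨ m≡ ⟩
  fromℕ w                                       ∎
  where
  open ≡-Reasoning
  identity : ∀ p K → 2 * p * K ≡ 2 * K * p
  identity = ℕ.solve-∀

module _ {k p : ℕ} .{{_ : NonZero p}} (C : Vec (Code (suc k)) p)
         {c : ℚ} (c-scaled : c ℚ.* fromℕ (2 * p * suc k) ≡ fromℕ (weight C)) where

  private
    instance
      2p≢0 : NonZero (2 * p)
      2p≢0 = ℕ.m*n≢0 2 p

  closedWalk-density : IsClosedWalk C → density S[ C ] ≈ᶜ fromℚ c
  closedWalk-density walk =
      density-≤ S[ C ] {c} {w} {2 * p} c-scaled′ (count-periodic-upper S[ C ] period (+ 5))
    , density-≥ S[ C ] {c} {w} {2 * p} c-scaled′ (count-periodic-lower S[ C ] period (+ 5))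
    where
    period : ∀ i j → S[ C ] (i , j) ≡ S[ C ] (i , j ℤ.+ + (2 * p))
    period = proj₂ (S[]-period C)
    w = count S[ C ] (+ 5) (2 * p)
    c-scaled′ : c ℚ.* fromℕ (2 * p * suc k) ≡ fromℕ w
    c-scaled′ = trans c-scaled (cong fromℕ (sym (count-weight C walk)))

  module _ (minimum : IsMinimumMeanCycle C) where

    private
      cycle-weight≥ : ∀ q (D : Vec (Code (suc k)) (suc q)) → IsCycle D → weight C * suc q ≤ weight D * p
      cycle-weight≥ q D D-cycle = mean-≤ C D (proj₂ minimum (suc q) D D-cycle)

    -- Minimality, cross-multiplied, is the hypothesis of the loop erasure. `count-lower` then
    -- bounds every window of `S` with one constant, whether or not `S` is periodic.
    minimumMean≤density : ∀ {S} → IsLDS (H (suc k)) S → fromℚ c ≤ᶜ density S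
    minimumMean≤density {S} lds = density-≥ S {c} {weight C} {2 * p} c-scaled (count-lower {w = weight C} {p} cycle-weight≥ lds)

    minimumMean≈minDensity : minDensity (suc k) ≈ᶜ fromℚ c
    minimumMean≈minDensity = inf-attained (λ (S : ∃ (IsLDS (H (suc k)))) → density (proj₁ S))
      (S[ C ] , proj₁ (closedWalk⇒periodicLDS C walk)) (proj₁ (closedWalk-density walk)) (λ (_ , lds) → minimumMean≤density lds)
      where
      walk = proj₁ (proj₁ minimum)

density-scaled : ∀ {k p} .{{_ : NonZero p}} (C : Vec (Code (suc k)) p) →
                 (mean C ÷ℕ (2 * suc k)) ℚ.* fromℕ (2 * p * suc k) ≡ fromℕ (weight C)
density-scaled {k} {p} C = mean-scaled {mean C ÷ℕ (2 * suc k)} {mean C} (suc k) p (weight C) (÷ℕ-*-fromℕ (mean C) (2 * suc k)) (mean-* C)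

minimumMeanCycle-optimal : ∀ {k p} .{{_ : NonZero p}} (C : Vec (Code (suc k)) p) → IsMinimumMeanCycle C →
  ∀ {S} → IsLDS (H (suc k)) S → density S[ C ] ≤ᶜ density S
minimumMeanCycle-optimal {k} C minimum {S} lds = ≤ᶜ-trans {density S[ C ]} {fromℚ (mean C ÷ℕ (2 * suc k))} {density S}
  (proj₁ (closedWalk-density C (density-scaled C) (proj₁ (proj₁ minimum)))) (minimumMean≤density C (density-scaled C) minimum {S} lds)

minimumMeanCycle-attains : ∀ {k p} .{{_ : NonZero p}} (C : Vec (Code (suc k)) p) → IsMinimumMeanCycle C →
  density S[ C ] ≈ᶜ minDensity (suc k)
minimumMeanCycle-attains {k} C minimum =
    ≤ᶜ-trans {density S[ C ]} {c} {minDensity (suc k)} (proj₁ S-density) (proj₂ min-density)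
  , ≤ᶜ-trans {minDensity (suc k)} {c} {density S[ C ]} (proj₁ min-density) (proj₂ S-density)
  where
  c = fromℚ (mean C ÷ℕ (2 * suc k))
  S-density : density S[ C ] ≈ᶜ c
  S-density = closedWalk-density C (density-scaled C) (proj₁ (proj₁ minimum))
  min-density : minDensity (suc k) ≈ᶜ c
  min-density = minimumMean≈minDensity C (density-scaled C) minimum

theorem3 : ∀ (k : ℕ) → 2 ≤ k →
    -- (a) equivalence for every length p, via closed walks
    ( (∀ p .{{_ : NonZero p}} →
        (∃[ C ] IsClosedWalk {k} {p} C) ⇔ (∃[ S ] IsPeriodicLDS {k} (2 * p) S))
    -- the same for cycles proper
    × (∀ p .{{_ : NonZero p}} →
        (∃[ C ] IsCycle {k} {p} C) ⇔ (∃[ S ] IsPeriodicLDS {k} (2 * p) S × DistinctWindows p S))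
    × ((∃[ n ] ∃[ C ] IsCycle {k} {suc n} C) ⇔ (∃[ n ] ∃[ S ] IsPeriodicLDS {k} (2 * suc n) S))
    -- the correspondence S = S_C behind both, and the density relation
    × (∀ p .{{_ : NonZero p}} (C : Vec (Code k) p) → IsClosedWalk C →
        IsPeriodicLDS (2 * p) S[ C ] × density S[ C ] ≈ᶜ fromℚ (mean C ÷ℕ (2 * k)))
    × (∀ p .{{_ : NonZero p}} (S : VertexSet (H k)) → IsPeriodicLDS (2 * p) S →
        ∃[ C ] IsClosedWalk {k} {p} C × S ≗ S[ C ])
    × (∀ p .{{_ : NonZero p}} (S : VertexSet (H k)) → IsPeriodicLDS (2 * p) S → DistinctWindows p S →
        ∃[ C ] IsCycle {k} {p} C × S ≗ S[ C ])
    -- minimum mean cycles yield minimum-density periodic sets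
    × (∀ p .{{_ : NonZero p}} (C : Vec (Code k) p) → IsMinimumMeanCycle C →
        IsPeriodicLDS (2 * p) S[ C ]
        × (∀ q (S : VertexSet (H k)) → IsPeriodicLDS q S → density S[ C ] ≤ᶜ density S)) )
    -- (b)
  × ( (∃[ q ] ∃[ S ] IsPeriodicLDS {k} q S × density S ≈ᶜ minDensity k)
    × (∃[ n ] ∃[ C ] IsMinimumMeanCycle {k} {suc n} C)
    × (∀ p .{{_ : NonZero p}} (C : Vec (Code k) p) → IsMinimumMeanCycle C →
        minDensity k ≈ᶜ fromℚ (mean C ÷ℕ (2 * k))) )
theorem3 (suc k) _ =
    ( (λ p → mk⇔ (λ (C , walk) → S[ C ] , closedWalk⇒periodicLDS C walk)
                 (λ (S , periodic) → walkOf S periodic , walkOf-closed S periodic))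
    , (λ p → mk⇔ (λ (C , walk , inj) → S[ C ] , closedWalk⇒periodicLDS C walk , cycle⇒distinctWindows C walk inj)
                 (λ (S , periodic , distinct) → walkOf S periodic , distinctWindows⇒cycle S periodic distinct))
    , mk⇔ (λ (n , C , walk , _) → n , S[ C ] , closedWalk⇒periodicLDS C walk)
          -- No length is prescribed in this equivalence, so a minimum mean cycle is a witness.
          (λ _ → let n , C , minimum = minimumMeanCycle (suc k) in n , C , proj₁ minimum)
    , (λ p C walk → closedWalk⇒periodicLDS C walk , closedWalk-density C (density-scaled C) walk)
    , (λ p S periodic → walkOf S periodic , walkOf-closed S periodic , S≗S[walkOf] S periodic)
    , (λ p S periodic distinct → walkOf S periodic , distinctWindows⇒cycle S periodic distinct , S≗S[walkOf] S periodic)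
    , (λ p C minimum → closedWalk⇒periodicLDS C (proj₁ (proj₁ minimum))
                     -- Optimality holds against every locating-dominating set, so the period `q` of
                     -- the competitor may be odd.
                     , λ q S periodic → minimumMeanCycle-optimal C minimum (proj₁ periodic)) )
  , (let n , C , minimum = minimumMeanCycle (suc k) in
      2 * suc n , S[ C ] , closedWalk⇒periodicLDS C (proj₁ (proj₁ minimum)) , minimumMeanCycle-attains C minimum)
  , minimumMeanCycle (suc k)
  , λ p C minimum → minimumMean≈minDensity C (density-scaled C) minimum
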